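{- For every integer $q \geq 2$, there exists a (polynomial-time) kernelization algorithm for the Dual Index Coding$_q$ problem, which given an instance $(G,k)$ (a graph $G$ and an integer $k \geq 0$) returns an equivalent instance $(G',k')$, where $G'$ has at most $\max(3k'-3,0)$ vertices and $k' \leq k$. Here equivalence means that $\mathrm{Ind}_q(G) \leq n-k$ if and only if $\mathrm{Ind}_q(G') \leq n'-k'$, where $n$ and $n'$ are the numbers of vertices of $G$ and $G'$ respectively.
   Context: All graphs are finite, undirected and simple; the graph $K_0$ with no vertices and no edges is allowed. $N_G(i)$ denotes the set of vertices adjacent to $i$ in $G$ (so $i \notin N_G(i)$), $[n]=\{1,\dots,n\}$, and $x_S$ denotes the restriction of a vector $x$ to the entries with indices in $S$. Index coding: an index code of length $\ell$ over an alphabet $\Sigma$ for a graph $G$ on the vertex set $[n]$ is a function $E:\Sigma^n \to \Sigma^\ell$ such that for each $i \in [n]$ there exists a decoding function $g_i:\Sigma^{\ell+|N_G(i)|} \to \Sigma$ satisfying $g_i(E(x),x_{N_G(i)})=x_i$ for all $x \in \Sigma^n$. For an integer $q \geq 2$, $\mathrm{Ind}_q(G)$ is the smallest integer $\ell \ge 0$ for which there exists an index code of length $\ell$ over $[q]$ for $G$. For a graph on an arbitrary $n$-element vertex set, identify the vertex set with $[n]$; in particular $\mathrm{Ind}_q(K_0)=0$. The Dual Index Coding$_q$ problem: given a graph $G$ on $n$ vertices and an integer $k \geq 0$, decide whether $\mathrm{Ind}_q(G) \leq n-k$; the parameter is $k$. A kernelization algorithm for a parameterized problem $L$ is an algorithm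 that, given an instance $(x,k)$, runs in polynomial time and returns an instance $(x',k')$ with $|x'|,k' \leq h(k)$ for some computable function $h:\mathbb{N}\to\mathbb{N}$, such that $(x,k) \in L$ if and only if $(x',k') \in L$ (the instances are then called equivalent). -}

module Defs where

open import Data.Bool using (Bool; true; false; if_then_else_; _∧_)
open import Data.Fin using (Fin; toℕ; fromℕ<)
open import Data.Fin.Subset using (Subset; inside; outside; ∣_∣)
open import Data.Integer as ℤ using (ℤ; +_)
open import Data.Nat using (ℕ; zero; suc; _+_; _*_; _∸_; _^_; _≤_; _<?_; _≡ᵇ_)
open import Data.Nat.Logarithm using (⌈log₂_⌉)
open import Data.Product using (Σ; ∃; ∃-syntax; Σ-syntax; _×_; _,_)
open import Data.Vec using (Vec; []; _∷_; _++_; lookup; tabulate)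
open import Function.Bundles using (_⇔_)
open import Relation.Binary.PropositionalEquality using (_≡_)
open import Relation.Nullary using (yes; no)

------------------------------------------------------------------------
-- Graphs and index codes

record Graph (n : ℕ) : Set where
  field
    adj    : Fin n → Fin n → Bool
    irrefl : ∀ i → adj i i ≡ false
    symm   : ∀ i j → adj i j ≡ adj j i

open Graph public

N : ∀ {n} → Graph n → Fin n → Subset n
N G i = tabulate (adj G i)

-- x ↾ S is x_S: the entries of x with index in S, in increasing order of
-- index.
_↾_ : ∀ {A : Set} {n} → Vec A n → (S : Subset n) → Vec A ∣ S ∣
[]      ↾ []            = []
(a ∷ x) ↾ (inside  ∷ S) = a ∷ (x ↾ S)
(a ∷ x) ↾ (outside ∷ S) = x ↾ S

IsIndexCode : (A : Set) {n : ℕ} → Graph n → (ℓ : ℕ) →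
              (Vec A n → Vec A ℓ) → Set
IsIndexCode A {n} G ℓ E =
  ∀ (i : Fin n) → Σ[ g ∈ (Vec A (ℓ + ∣ N G i ∣) → A) ]
    (∀ (x : Vec A n) → g (E x ++ (x ↾ N G i)) ≡ lookup x i)

HasIndexCode : (A : Set) {n : ℕ} → Graph n → ℕ → Set
HasIndexCode A {n} G ℓ = Σ[ E ∈ (Vec A n → Vec A ℓ) ] IsIndexCode A G ℓ E

-- IsInd q G ℓ says that Ind_q(G) = ℓ.
IsInd : (q : ℕ) {n : ℕ} → Graph n → ℕ → Set
IsInd q G ℓ =
  HasIndexCode (Fin q) G ℓ ×
  (∀ ℓ′ → HasIndexCode (Fin q) G ℓ′ → ℓ ≤ ℓ′)

------------------------------------------------------------------------
-- Parameterized graph problems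

record Instance : Set where
  constructor instance-of
  field
    {order} : ℕ
    graph   : Graph order
    param   : ℕ

open Instance public

Problem : Set₁
Problem = Instance → Set

-- The difference n - k is taken in ℤ, since k may exceed n.
DualIndexCoding : ℕ → Problem
DualIndexCoding q I =
  ∃[ ℓ ] (IsInd q (graph I) ℓ × + ℓ ℤ.≤ + order I ℤ.- + param I)

-- Size of an adjacency matrix.
graphSize : ∀ {n} → Graph n → ℕ
graphSize {n} _ = n * n

-- The parameter is charged for its binary length only, so that a running
-- time polynomial in this size is also polynomial in |G| + k.
instanceSize : Instance → ℕ
instanceSize I = graphSize (graph I) + ⌈log₂ suc (param I) ⌉

------------------------------------------------------------------------
-- Machine model: structured programs for a random access machine whose
-- memory consists of two-dimensional arrays of natural numbers (array
-- names are literals of the program, indices are computed).  The only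
-- arithmetic operations are addition and truncated subtraction, each at
-- unit cost.  A unit-cost operation lengthens the largest number in use
-- by at most one bit (multiplication, which could double the length, is
-- not available), so polynomial time here coincides with polynomial time
-- on Turing machines.

Name : Set
Name = ℕ

Store : Set
Store = Name → ℕ → ℕ → ℕ

infixl 6 _⊕_ _⊖_

data Exp : Set where
  lit  : ℕ → Exp
  _⊕_  : Exp → Exp → Exp
  _⊖_  : Exp → Exp → Exp
  read : Name → Exp → Exp → Exp

⟦_⟧ : Exp → Store → ℕ
⟦ lit v ⟧        σ = v
⟦ e₁ ⊕ e₂ ⟧      σ = ⟦ e₁ ⟧ σ + ⟦ e₂ ⟧ σ
⟦ e₁ ⊖ e₂ ⟧      σ = ⟦ e₁ ⟧ σ ∸ ⟦ e₂ ⟧ σ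
⟦ read a e₁ e₂ ⟧ σ = σ a (⟦ e₁ ⟧ σ) (⟦ e₂ ⟧ σ)

cost : Exp → ℕ
cost (lit v)        = 1
cost (e₁ ⊕ e₂)      = suc (cost e₁ + cost e₂)
cost (e₁ ⊖ e₂)      = suc (cost e₁ + cost e₂)
cost (read a e₁ e₂) = suc (cost e₁ + cost e₂)

infixr 4 _⨾_

data Cmd : Set where
  skip    : Cmd
  write   : Name → Exp → Exp → Exp → Cmd
  _⨾_     : Cmd → Cmd → Cmd
  ifnz    : Exp → Cmd → Cmd → Cmd
  whilenz : Exp → Cmd → Cmd

update : Store → Name → ℕ → ℕ → ℕ → Store
update σ a i j v b k l =
  if (a ≡ᵇ b) ∧ (i ≡ᵇ k) ∧ (j ≡ᵇ l) then v else σ b k l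

-- ⟨ c , σ ⟩⇓[ t ] τ: started in store σ, c halts in store τ after t steps.
-- Guards are true when nonzero.
infix 3 ⟨_,_⟩⇓[_]_

data ⟨_,_⟩⇓[_]_ : Cmd → Store → ℕ → Store → Set where

  ⇓skip : ∀ {σ} → ⟨ skip , σ ⟩⇓[ 1 ] σ

  ⇓write : ∀ {σ a e₁ e₂ e} →
    ⟨ write a e₁ e₂ e , σ ⟩⇓[ suc (cost e₁ + cost e₂ + cost e) ]
      update σ a (⟦ e₁ ⟧ σ) (⟦ e₂ ⟧ σ) (⟦ e ⟧ σ)

  ⇓seq : ∀ {c d σ τ υ s t} →
    ⟨ c , σ ⟩⇓[ s ] τ → ⟨ d , τ ⟩⇓[ t ] υ →
    ⟨ c ⨾ d , σ ⟩⇓[ s + t ] υ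

  ⇓if-nonzero : ∀ {e c d σ τ v t} →
    ⟦ e ⟧ σ ≡ suc v → ⟨ c , σ ⟩⇓[ t ] τ →
    ⟨ ifnz e c d , σ ⟩⇓[ suc (cost e + t) ] τ

  ⇓if-zero : ∀ {e c d σ τ t} →
    ⟦ e ⟧ σ ≡ 0 → ⟨ d , σ ⟩⇓[ t ] τ →
    ⟨ ifnz e c d , σ ⟩⇓[ suc (cost e + t) ] τ

  ⇓while-nonzero : ∀ {e c σ τ υ v s t} →
    ⟦ e ⟧ σ ≡ suc v → ⟨ c , σ ⟩⇓[ s ] τ → ⟨ whilenz e c , τ ⟩⇓[ t ] υ →
    ⟨ whilenz e c , σ ⟩⇓[ suc (cost e + s + t) ] υ

  ⇓while-zero : ∀ {e c σ} →
    ⟦ e ⟧ σ ≡ 0 →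
    ⟨ whilenz e c , σ ⟩⇓[ suc (cost e) ] σ

------------------------------------------------------------------------
-- Input and output conventions

bit : Bool → ℕ
bit b = if b then 1 else 0

matrix : ∀ {n} → Graph n → ℕ → ℕ → ℕ
matrix {n} G i j with i <? n | j <? n
... | yes i<n | yes j<n = bit (adj G (fromℕ< i<n) (fromℕ< j<n))
... | _       | _       = 0

-- Cell (0,0) of array 0 holds the number of vertices, cell (0,0) of array 1
-- the parameter, and array 2 the adjacency matrix.  All other cells are 0.
input : Instance → Store
input I 0 0 0 = order I
input I 1 0 0 = param I
input I 2 i j = matrix (graph I) i j
input I _ _ _ = 0

-- Same layout as for the input, but the remaining cells are unconstrained.
Outputs : Store → Instance → Set
Outputs σ I =
  σ 0 0 0 ≡ order I ×
  σ 1 0 0 ≡ param I ×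
  (∀ (i j : Fin (order I)) → σ 2 (toℕ i) (toℕ j) ≡ bit (adj (graph I) i j))

inputℕ : ℕ → Store
inputℕ v 0 0 0 = v
inputℕ v _ _ _ = 0

Computable : (ℕ → ℕ) → Set
Computable h =
  ∃[ c ] (∀ v → ∃[ t ] ∃[ τ ] (⟨ c , inputℕ v ⟩⇓[ t ] τ × τ 0 0 0 ≡ h v))

PolynomialTime : (Instance → ℕ) → Set
PolynomialTime time =
  ∃[ a ] ∃[ d ] (∀ I → time I ≤ a * instanceSize I ^ d + a)

------------------------------------------------------------------------
-- Kernelization

record Kernelization (L : Problem) : Set where
  field
    program    : Cmd
    time       : Instance → ℕ
    kernel     : Instance → Instance
    computes   : ∀ I → ∃[ τ ] (⟨ program , input I ⟩⇓[ time I ] τ ×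
                               Outputs τ (kernel I))
    polynomial : PolynomialTime time
    equivalent : ∀ I → L I ⇔ L (kernel I)
    bound      : ℕ → ℕ
    computable : Computable bound
    size-≤     : ∀ I → graphSize (graph (kernel I)) ≤ bound (param I)
    param-≤    : ∀ I → param (kernel I) ≤ bound (param I)

open Kernelization public

{-# OPTIONS --safe #-}
module Submission where

-- Let every vertex bid in an auction for one of its neighbours: an unserved
-- vertex takes its cheapest neighbour, whose price rises by one and whose
-- previous holder becomes unserved.  When all neighbours of u cost more than
-- n, some t ≤ n is not a price, and the items above t violate Hall's condition
-- together with their holders and u; this yields a crown with a spare vertex
-- u, so Ind_q(G - u) = Ind_q(G) - 1 and u can be deleted without changing k.
-- When the auction ends, the c surviving vertices are permuted by a map τ with
-- v adjacent to τ v, so they contain a matching with at least c / 3 edges;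
-- hence c > 3k - 3 makes the instance positive, and otherwise the surviving
-- graph is the kernel.
-- On the coding side, every edge of a matching saves one symbol (send the sum
-- of the values at its ends), and an isolated vertex costs one: the messages
-- are partitioned by the value that they determine, so one class is small.

open import Defs
open import Data.Bool using (Bool; true; false; T)
import Data.Bool.Properties as Bool
open import Data.Fin as Fin using (Fin; zero; suc; toℕ; fromℕ<; combine; funToFin; finToFun; inject≤)
open import Data.Fin.Properties as Fin using (any?; all?; combine-injective; finToFun-funToFin; injective⇒≤)
open import Data.Fin.Subset using (Subset; inside; outside; ∣_∣)
import Data.Integer as ℤ
import Data.Integer.Properties as ℤ
open import Data.List as List using (List; []; _∷_; length; filter; allFin)
open import Data.List.Membership.Propositional using (_∈_; _∉_)
open import Data.List.Membership.Propositional.Properties using (∈-filter⁺; ∈-filter⁻; ∈-allFin; ∈-++⁺ˡ; ∈-++⁺ʳ)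
open import Data.List.Relation.Unary.Unique.Propositional.Properties using (filter⁺; allFin⁺)
open import Data.List.Relation.Unary.All.Properties as All using (all-filter)
open import Data.List.Properties using (length-tabulate; length-filter; length-++)
open import Data.List.Relation.Unary.Any as Any using (here; there)
open import Data.List.Relation.Unary.Any.Properties using (lookup-index)
open import Data.List.Relation.Unary.All as All using (All; []; _∷_)
open import Data.List.Relation.Unary.AllPairs using (AllPairs; []; _∷_)
open import Data.List.Relation.Unary.Unique.Propositional using (Unique)
open import Data.Nat
open import Data.Nat.Properties
open import Data.Nat.DivMod
open import Data.Nat.Tactic.RingSolver using (solve-∀)
open import Data.Product using (∃; ∃-syntax; Σ-syntax; _×_; _,_; proj₁; proj₂)
open import Data.Sum as Sum using (_⊎_; inj₁; inj₂)
open import Data.Unit using (⊤; tt)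
open import Data.Vec as Vec using (Vec; []; _∷_; _++_; lookup; tabulate; _[_]≔_; replicate)
open import Data.Vec.Properties as Vec using (lookup∘tabulate; tabulate∘lookup; tabulate-cong; lookup∘updateAt; lookup∘updateAt′; lookup-replicate)
open import Function using (_∘_; id; case_of_)
open import Function.Bundles using (_⇔_; mk⇔)
open import Relation.Binary.PropositionalEquality
open import Relation.Nullary using (¬_; Dec; yes; no; contradiction)
open import Relation.Nullary.Decidable as Dec using (_×-dec_; _⊎-dec_; _→-dec_; ¬?)

-- Codes are arbitrary functions, so the messages left after peeling form a bare set without
-- coordinates. Hence `Code` counts messages, a saved symbol reads `q * m′ ≤ m`, and lengths return
-- only as exponents of `q`. The auction is matching in the bipartite double cover, where each
-- vertex is an item and a bidder. The Hall violator and the crown live only in the proof: the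
-- program deletes `u` alone, keeps all other prices and goes on bidding, without any search for
-- alternating paths. The factor 3 is the price of the double cover: a perfect matching there is
-- only a permutation of the survivors, and on disjoint triangles a matching of the graph has one
-- edge per three vertices. The summand -3 is integrality: `3 (k - 1) < c ≤ 3 s` forces `k ≤ s`.

funToFin-cong : ∀ {m n} {f g : Fin m → Fin n} → (∀ i → f i ≡ g i) → funToFin f ≡ funToFin g
funToFin-cong {zero}  f≗g = refl
funToFin-cong {suc m} f≗g = cong₂ combine (f≗g zero) (funToFin-cong (f≗g ∘ suc))

injective⇒surjective : ∀ {n} (f : Fin n → Fin n) → (∀ {x y} → f x ≡ f y → x ≡ y) → ∀ y → ∃[ x ] f x ≡ y
injective⇒surjective {suc n} f f-inj y with any? (λ x → f x Fin.≟ y)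
... | yes hit = hit
... | no miss = contradiction (injective⇒≤ {f = λ x → Fin.punchOut (avoid x)} λ {a} {b} eq → f-inj
    (Fin.punchOut-injective (avoid a) (avoid b) eq)) 1+n≰n
  where
  avoid : ∀ x → y ≢ f x
  avoid x eq = miss (x , sym eq)

-- Vectors: extensionality, exhaustive search, restriction

vec-ext : ∀ {A : Set} {n} {x y : Vec A n} → (∀ i → lookup x i ≡ lookup y i) → x ≡ y
vec-ext {x = x} {y} x≗y =
  trans (sym (tabulate∘lookup x)) (trans (tabulate-cong x≗y) (tabulate∘lookup y))

any-vec? : ∀ {k} n {P : Vec (Fin k) n → Set} → (∀ x → Dec (P x)) → Dec (∃ P)
any-vec? zero    P? = Dec.map′ ([] ,_) (λ { ([] , p) → p }) (P? [])
any-vec? (suc n) P? =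
  Dec.map′ (λ { (a , x , p) → a ∷ x , p }) (λ { (a ∷ x , p) → a , x , p })
           (any? λ a → any-vec? n λ x → P? (a ∷ x))

all-vec? : ∀ {k} n {P : Vec (Fin k) n → Set} → (∀ x → Dec (P x)) → Dec (∀ x → P x)
all-vec? n P? with any-vec? n (¬? ∘ P?)
... | yes (x , ¬p) = no λ p → ¬p (p x)
... | no ∄         = yes λ x → Dec.decidable-stable (P? x) λ ¬p → ∄ (x , ¬p)

↾-cong : ∀ {A : Set} {n} (S : Subset n) (x y : Vec A n) →
         (∀ j → lookup S j ≡ true → lookup x j ≡ lookup y j) → x ↾ S ≡ y ↾ S
↾-cong []            []      []      h = refl
↾-cong (inside  ∷ S) (a ∷ x) (b ∷ y) h = cong₂ _∷_ (h zero refl) (↾-cong S x y λ j → h (suc j))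
↾-cong (outside ∷ S) (a ∷ x) (b ∷ y) h = ↾-cong S x y λ j → h (suc j)

↾-injective : ∀ {A : Set} {n} (S : Subset n) (x y : Vec A n) → x ↾ S ≡ y ↾ S →
              ∀ j → lookup S j ≡ true → lookup x j ≡ lookup y j
↾-injective (inside  ∷ S) (a ∷ x) (b ∷ y) eq zero    j∈S = cong Vec.head eq
↾-injective (inside  ∷ S) (a ∷ x) (b ∷ y) eq (suc j) j∈S = ↾-injective S x y (cong Vec.tail eq) j j∈S
↾-injective (outside ∷ S) (a ∷ x) (b ∷ y) eq (suc j) j∈S = ↾-injective S x y eq j j∈S

lookup-N : ∀ {n} (G : Graph n) i j → lookup (N G i) j ≡ adj G i j
lookup-N G i = lookup∘tabulate (adj G i)

-- Averaging: a smallest fibre of a finite map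

module _ {m : ℕ} where

  length-filter-⊎ : ∀ {P Q R : Fin m → Set}
    (P? : ∀ z → Dec (P z)) (Q? : ∀ z → Dec (Q z)) (R? : ∀ z → Dec (R z)) →
    (∀ z → P z → ¬ Q z) → (∀ z → P z ⊎ Q z → R z) → (∀ z → R z → P z ⊎ Q z) → ∀ zs →
    length (filter P? zs) + length (filter Q? zs) ≡ length (filter R? zs)
  length-filter-⊎ P? Q? R? disj to from []       = refl
  length-filter-⊎ P? Q? R? disj to from (z ∷ zs) with P? z | Q? z | R? z | length-filter-⊎ P? Q? R? disj to
      from zs
  ... | yes p | yes q | _     | _  = contradiction q (disj z p)
  ... | yes p | no q  | yes r | IH = cong suc IH
  ... | no p  | yes q | yes r | IH = trans (+-suc _ _) (cong suc IH)
  ... | no p  | no q  | no r  | IH = IH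
  ... | yes p | no q  | no r  | _  = contradiction (to z (inj₁ p)) r
  ... | no p  | yes q | no r  | _  = contradiction (to z (inj₂ q)) r
  ... | no p  | no q  | yes r | _  with from z r
  ...   | inj₁ p′ = contradiction p′ p
  ...   | inj₂ q′ = contradiction q′ q

  length-filter-< : ∀ (g : Fin m → ℕ) c zs →
    length (filter (λ z → g z <? c) zs) + length (filter (λ z → g z ≟ c) zs) ≡
    length (filter (λ z → g z <? suc c) zs)
  length-filter-< g c = length-filter-⊎ (λ z → g z <? c) (λ z → g z ≟ c) (λ z → g z <? suc c)
    (λ z → <⇒≢) (λ { z (inj₁ p) → m<n⇒m<1+n p ; z (inj₂ e) → s≤s (≤-reflexive e) })
    (λ z p → m≤n⇒m<n∨m≡n (≤-pred p))

  -- A running minimum: the class kept so far is replaced by the next one whenever that is smaller,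
  -- so each of the `suc k` classes has at least the size of the one kept.
  small-class : ∀ (g : Fin m → ℕ) zs k →
    ∃[ c ] (c < suc k × suc k * length (filter (λ z → g z ≟ c) zs) ≤
                        length (filter (λ z → g z <? suc k) zs))
  small-class g zs k = go k
    where
    class below : ℕ → ℕ
    class c = length (filter (λ z → g z ≟ c) zs)
    below c = length (filter (λ z → g z <? c) zs)
    extend : ∀ k {s} → suc k * s ≤ below (suc k) → s ≤ class (suc k) → suc (suc k) * s ≤ below (suc (suc k))
    extend k {s} le le′ = subst (_ ≤_) (trans (+-comm (class (suc k)) (below (suc k)))
        (length-filter-< g (suc k) zs))
                            (+-mono-≤ le′ le)
    go : ∀ k → ∃[ c ] (c < suc k × suc k * class c ≤ below (suc k))
    go zero = 0 , s≤s z≤n ,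
      subst₂ _≤_ (sym (*-identityˡ (class 0))) (length-filter-< g 0 zs) (m≤n+m (class 0) (below 0))
    go (suc k) with go k
    ... | c , c<k , IH with ≤-total (class c) (class (suc k))
    ...   | inj₁ le = c , m<n⇒m<1+n c<k , extend k IH le
    ...   | inj₂ ge = suc k , ≤-refl , extend k (≤-trans (*-monoʳ-≤ (suc k) ge) IH) ≤-refl

  abstract
    -- The injection `ρ` is the position in the list of the fibre; it serves to rename the messages
    -- of one fibre.
    smallest-fibre : ∀ {k} (g : Fin m → Fin (suc k)) →
      Σ[ c ∈ Fin (suc k) ] ∃[ m′ ] (suc k * m′ ≤ m ×
        Σ[ ρ ∈ (∀ z → g z ≡ c → Fin m′) ] (∀ z z′ p p′ → ρ z p ≡ ρ z′ p′ → z ≡ z′))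
    smallest-fibre {k} g = fromℕ< c<k , length class ,
      ≤-trans le (≤-trans (length-filter _ (allFin m)) (≤-reflexive (length-tabulate _))) ,
      (λ z p → Any.index (mem z p)) ,
      λ z z′ p p′ eq → trans (lookup-index (mem z p))
        (trans (cong (List.lookup class) eq) (sym (lookup-index (mem z′ p′))))
      where
      found : ∃[ c ] (c < suc k × suc k * length (filter (λ z → toℕ (g z) ≟ c) (allFin m)) ≤
                        length (filter (λ z → toℕ (g z) <? suc k) (allFin m)))
      found = small-class (toℕ ∘ g) (allFin m) k
      c : ℕ
      c = proj₁ found
      c<k : c < suc k
      c<k = proj₁ (proj₂ found)
      class : List (Fin m)
      class = filter (λ z → toℕ (g z) ≟ c) (allFin m)
      le : suc k * length class ≤ length (filter (λ z → toℕ (g z) <? suc k) (allFin m))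
      le = proj₂ (proj₂ found)
      mem : ∀ z → g z ≡ fromℕ< c<k → z ∈ class
      mem z p = ∈-filter⁺ _ (∈-allFin z) (trans (cong toℕ p) (Fin.toℕ-fromℕ< c<k))

-- Addition modulo q

module _ {r : ℕ} where

  private q = suc r

  infixl 6 _⊞_
  _⊞_ : Fin q → Fin q → Fin q
  a ⊞ b = fromℕ< (m%n<n (toℕ a + toℕ b) q)

  ⊞-comm : ∀ a b → a ⊞ b ≡ b ⊞ a
  ⊞-comm a b = Fin.fromℕ<-cong _ _ (cong (_% q) (+-comm (toℕ a) (toℕ b))) _ _

  -- Adding `q ∸ toℕ a` modulo `q` recovers `b` from `a ⊞ b`.
  ⊞-cancelˡ : ∀ a {b c} → a ⊞ b ≡ a ⊞ c → b ≡ c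
  ⊞-cancelˡ a {b} {c} eq = Fin.toℕ-injective (trans (recover b)
      (trans (cong (λ s → ((q ∸ toℕ a) % q + toℕ s) % q) eq) (sym (recover c))))
    where
    recover : ∀ b → toℕ b ≡ ((q ∸ toℕ a) % q + toℕ (a ⊞ b)) % q
    recover b = begin
      toℕ b                                    ≡⟨ m<n⇒m%n≡m (Fin.toℕ<n b) ⟨
      toℕ b % q                                ≡⟨ [m+n]%n≡m%n (toℕ b) q ⟨
      (toℕ b + q) % q                          ≡⟨ cong (_% q) (+-comm (toℕ b) q) ⟩
      (q + toℕ b) % q                          ≡⟨ cong (λ s → (s + toℕ b) % q) (m∸n+n≡m (<⇒≤ (Fin.toℕ<n a))) ⟨
      (q ∸ toℕ a + toℕ a + toℕ b) % q          ≡⟨ cong (_% q) (+-assoc (q ∸ toℕ a) _ _) ⟩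
      (q ∸ toℕ a + (toℕ a + toℕ b)) % q        ≡⟨ %-distribˡ-+ (q ∸ toℕ a) _ q ⟩
      ((q ∸ toℕ a) % q + (toℕ a + toℕ b) % q) % q ≡⟨ cong (λ s → ((q ∸ toℕ a) % q + s) % q)
          (Fin.toℕ-fromℕ< (m%n<n (toℕ a + toℕ b) q)) ⟨
      ((q ∸ toℕ a) % q + toℕ (a ⊞ b)) % q ∎
      where open ≡-Reasoning

-- Finite sums and the change of one term

sumTo : (ℕ → ℕ) → ℕ → ℕ
sumTo f zero    = 0
sumTo f (suc n) = sumTo f n + f n

sumTo-cong : ∀ {f g} n → (∀ v → v < n → f v ≡ g v) → sumTo f n ≡ sumTo g n
sumTo-cong zero    f≗g = refl
sumTo-cong (suc n) f≗g = cong₂ _+_ (sumTo-cong n λ v v<n → f≗g v (m<n⇒m<1+n v<n)) (f≗g n ≤-refl)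

-- Each sum receives the term that the other one has at `u`; in this form no subtraction occurs.
sumTo-update : ∀ {f g} n {u} → u < n → (∀ v → v ≢ u → f v ≡ g v) → sumTo f n + g u ≡ sumTo g n + f u
sumTo-update {f} {g} (suc n) {u} u<n f≗g with m≤n⇒m<n∨m≡n (≤-pred u<n)
... | inj₂ refl = trans (cong (λ s → s + f n + g n) (sumTo-cong n λ v v<n → f≗g v (<⇒≢ v<n)))
                    (swap (sumTo g n) (f n) (g n))
  where
  swap : ∀ a b c → a + b + c ≡ a + c + b
  swap = solve-∀
... | inj₁ u<n′ = begin
  sumTo f n + f n + g u   ≡⟨ swap (sumTo f n) (f n) (g u) ⟩
  sumTo f n + g u + f n   ≡⟨ cong₂ _+_ (sumTo-update n u<n′ f≗g) (f≗g n (<⇒≢ u<n′ ∘ sym)) ⟩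
  sumTo g n + f u + g n   ≡⟨ swap (sumTo g n) (f u) (g n) ⟩
  sumTo g n + g n + f u   ∎
  where
  open ≡-Reasoning
  swap : ∀ a b c → a + b + c ≡ a + c + b
  swap = solve-∀

sumTo-decreases : ∀ {f g} n {u} → u < n → (∀ v → v ≢ u → f v ≡ g v) → f u < g u → sumTo f n < sumTo g n
sumTo-decreases {f} {g} n {u} u<n f≗g lt = +-cancelʳ-< (g u) (sumTo f n) (sumTo g n)
  (subst (_< sumTo g n + g u) (sym (sumTo-update n u<n f≗g)) (+-monoʳ-< (sumTo g n) lt))

sgn : ℕ → ℕ
sgn zero    = 0
sgn (suc _) = 1

sgn-pos : ∀ {v} → 0 < v → sgn v ≡ 1
sgn-pos (s≤s _) = refl

-- Program logic with time bounds

record Run (c : Cmd) (σ : Store) (T : ℕ) (Q : Store → Set) : Set where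
  constructor halts
  field
    {steps} : ℕ
    {final} : Store
    exec    : ⟨ c , σ ⟩⇓[ steps ] final
    steps≤  : steps ≤ T
    post    : Q final

run-weaken : ∀ {c σ S T Q} → S ≤ T → Run c σ S Q → Run c σ T Q
run-weaken S≤T (halts e t≤ post) = halts e (≤-trans t≤ S≤T) post

run-map : ∀ {c σ T} {P Q : Store → Set} → (∀ {τ} → P τ → Q τ) → Run c σ T P → Run c σ T Q
run-map P⇒Q (halts e t≤ post) = halts e t≤ (P⇒Q post)

run-skip : ∀ {σ} {Q : Store → Set} → Q σ → Run skip σ 1 Q
run-skip post = halts ⇓skip ≤-refl post

run-write : ∀ {σ a e₁ e₂ e} {Q : Store → Set} → Q (update σ a (⟦ e₁ ⟧ σ) (⟦ e₂ ⟧ σ) (⟦ e ⟧ σ)) →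
            Run (write a e₁ e₂ e) σ (suc (cost e₁ + cost e₂ + cost e)) Q
run-write post = halts ⇓write ≤-refl post

run-write-then : ∀ {a e₁ e₂ e d σ T Q} → Run d (update σ a (⟦ e₁ ⟧ σ) (⟦ e₂ ⟧ σ) (⟦ e ⟧ σ)) T Q →
                 Run (write a e₁ e₂ e ⨾ d) σ (suc (cost e₁ + cost e₂ + cost e) + T) Q
run-write-then (halts e t≤ post) = halts (⇓seq ⇓write e) (+-monoʳ-≤ _ t≤) post

infixr 4 _then_
_then_ : ∀ {c d σ S T P Q} → Run c σ S P → (∀ {τ} → P τ → Run d τ T Q) → Run (c ⨾ d) σ (S + T) Q
halts e s≤ p then k with k p
... | halts e′ t≤ post = halts (⇓seq e e′) (+-mono-≤ s≤ t≤) post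

-- Both branches are charged, so that the bound is independent of the guard.
run-if : ∀ {e c d σ S T Q} → (0 < ⟦ e ⟧ σ → Run c σ S Q) → (⟦ e ⟧ σ ≡ 0 → Run d σ T Q) →
         Run (ifnz e c d) σ (suc (cost e + (S + T))) Q
run-if {e} {σ = σ} {S} {T} yes-case no-case with ⟦ e ⟧ σ in eq
... | zero  with no-case refl
...   | halts x t≤ post = halts (⇓if-zero eq x) (s≤s (+-monoʳ-≤ (cost e) (≤-trans t≤ (m≤n+m T S)))) post
run-if {e} {σ = σ} {S} {T} yes-case no-case | suc v with yes-case (s≤s z≤n)
...   | halts x t≤ post = halts (⇓if-nonzero eq x) (s≤s (+-monoʳ-≤ (cost e) (≤-trans t≤ (m≤m+n S T)))) post

-- One failing test, and `M` rounds that each pay for a test and the body.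
whileTime : Exp → ℕ → ℕ → ℕ
whileTime e T M = suc (cost e) + M * (suc (cost e) + T)

run-while : ∀ {e c} T (Inv : Store → Set) (μ : Store → ℕ) →
  (∀ {σ} → Inv σ → 0 < ⟦ e ⟧ σ → Run c σ T (λ τ → Inv τ × μ τ < μ σ)) →
  ∀ M {σ} → Inv σ → μ σ ≤ M → Run (whilenz e c) σ (whileTime e T M) (λ τ → Inv τ × ⟦ e ⟧ τ ≡ 0)
run-while {e} {c} T Inv μ body = go
  where
  go : ∀ M {σ} → Inv σ → μ σ ≤ M → Run (whilenz e c) σ (whileTime e T M) (λ τ → Inv τ × ⟦ e ⟧ τ ≡ 0)
  go M {σ} inv μ≤M with ⟦ e ⟧ σ in eq
  ... | zero = halts (⇓while-zero eq) (m≤m+n _ _) (inv , eq)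
  ... | suc v with body inv (subst (0 <_) (sym eq) (s≤s z≤n))
  go zero    inv μ≤M | suc v | halts x s≤ (inv′ , drop) = contradiction (≤-trans drop μ≤M) λ ()
  go (suc M) inv μ≤M | suc v | halts {s} x s≤ (inv′ , drop) with go M inv′ (≤-pred (≤-trans drop μ≤M))
  ... | halts {t} y t≤ post = halts (⇓while-nonzero eq x y) within post
    where
    rearrange : ∀ c T m → c + T + (c + m) ≡ c + ((c + T) + m)
    rearrange = solve-∀
    within : suc (cost e + s + t) ≤ whileTime e T (suc M)
    within = ≤-trans (+-mono-≤ (s≤s (+-monoʳ-≤ (cost e) s≤)) t≤)
             (≤-reflexive (rearrange (suc (cost e)) T (M * (suc (cost e) + T))))

≡ᵇ-refl : ∀ a → (a ≡ᵇ a) ≡ true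
≡ᵇ-refl zero    = refl
≡ᵇ-refl (suc a) = ≡ᵇ-refl a

≢⇒≡ᵇ-false : ∀ {a b} → a ≢ b → (a ≡ᵇ b) ≡ false
≢⇒≡ᵇ-false {a} {b} a≢b with a ≡ᵇ b in eq
... | false = refl
... | true  = contradiction (≡ᵇ⇒≡ a b (subst T (sym eq) tt)) a≢b

update-at : ∀ σ a {i j k l} v → i ≡ k → j ≡ l → update σ a i j v a k l ≡ v
update-at σ a {i} {j} v refl refl rewrite ≡ᵇ-refl a | ≡ᵇ-refl i | ≡ᵇ-refl j = refl

update-row : ∀ σ a {i j k l} v → i ≢ k → update σ a i j v a k l ≡ σ a k l
update-row σ a v i≢k rewrite ≡ᵇ-refl a | ≢⇒≡ᵇ-false i≢k = refl

update-column : ∀ σ a {i j k l} v → j ≢ l → update σ a i j v a k l ≡ σ a k l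
update-column σ a {i} {k = k} v j≢l rewrite ≡ᵇ-refl a | ≢⇒≡ᵇ-false j≢l with i ≡ᵇ k
... | true  = refl
... | false = refl

update-name : ∀ σ {a b} i j v k l → a ≢ b → update σ a i j v b k l ≡ σ b k l
update-name σ i j v k l a≢b rewrite ≢⇒≡ᵇ-false a≢b = refl

-- Counting loops and filling a matrix

var : Name → Exp
var x = read x (lit 0) (lit 0)

infix 5 _≔_
_≔_ : Name → Exp → Cmd
x ≔ e = write x (lit 0) (lit 0) e

for : Name → Exp → Cmd → Cmd
for x e c = x ≔ lit 0 ⨾ whilenz (e ⊖ var x) (c ⨾ x ≔ var x ⊕ lit 1)

forTime : Name → Exp → ℕ → ℕ → ℕ
forTime x e T N = 4 + whileTime (e ⊖ var x) (T + 8) N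

-- `Inv` speaks of the store in which the counter is already set, so the body answers for the
-- closing increment. For concrete array names that update computes away, and whatever the body
-- leaves alone carries over unchanged.
run-for : ∀ {x e c} N T (Inv : ℕ → Store → Set) →
  (∀ {j σ} → Inv j σ → ⟦ e ⟧ σ ≡ N) →
  (∀ {j σ} → j < N → σ x 0 0 ≡ j → Inv j σ →
    Run c σ T (λ τ → τ x 0 0 ≡ j × Inv (suc j) (update τ x 0 0 (suc j)))) →
  ∀ {σ} → Inv 0 (update σ x 0 0 0) → Run (for x e c) σ (forTime x e T N) (Inv N)
run-for {x} {e} {c} N T Inv bound body {σ} init =
  run-write {Q = Inv′} (0 , update-at σ x 0 refl refl , z≤n , init) then λ {τ} inv →
  run-map exit (run-while (T + 8) Inv′ (λ σ → N ∸ σ x 0 0) step N inv (m∸n≤m N (τ x 0 0)))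
  where
  Inv′ : Store → Set
  Inv′ σ = ∃[ j ] (σ x 0 0 ≡ j × j ≤ N × Inv j σ)
  exit : ∀ {τ} → Inv′ τ × ⟦ e ⊖ var x ⟧ τ ≡ 0 → Inv N τ
  exit {τ} ((j , x≡j , j≤N , inv) , done) = subst (λ j → Inv j τ) (≤-antisym j≤N (m∸n≡0⇒m≤n
    (trans (cong₂ _∸_ (sym (bound inv)) (sym x≡j)) done))) inv
  step : ∀ {σ} → Inv′ σ → 0 < ⟦ e ⊖ var x ⟧ σ →
         Run (c ⨾ x ≔ var x ⊕ lit 1) σ (T + 8) (λ τ → Inv′ τ × N ∸ τ x 0 0 < N ∸ σ x 0 0)
  step {σ} (j , x≡j , j≤N , inv) guard = body j<N x≡j inv then λ {τ} (τx≡j , inv′) →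
    run-write ((suc j , next τ τx≡j , j<N , subst (λ v → Inv (suc j) (update τ x 0 0 v)) (sym (incr τ τx≡j))
        inv′) ,
      subst₂ (λ a b → N ∸ a < N ∸ b) (sym (next τ τx≡j)) (sym x≡j) (∸-monoʳ-< ≤-refl j<N))
    where
    j<N : j < N
    j<N = m∸n≢0⇒n<m λ eq → <⇒≢ guard (sym (trans (cong₂ _∸_ (bound inv) x≡j) eq))
    incr : ∀ τ → τ x 0 0 ≡ j → τ x 0 0 + 1 ≡ suc j
    incr τ eq = trans (+-comm _ 1) (cong suc eq)
    next : ∀ τ (eq : τ x 0 0 ≡ j) → update τ x 0 0 (τ x 0 0 + 1) x 0 0 ≡ suc j
    next τ eq = trans (update-at τ x _ refl refl) (incr τ eq)

fill : Name → Exp → Cmd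
fill a e = for 14 (var 0) (for 15 (var 0) (write a (var 14) (var 15) e))

fillTime : Exp → ℕ → ℕ
fillTime e N = forTime 14 (var 0) (forTime 15 (var 0) (suc (6 + cost e)) N) N

-- Since `a` is a variable, updates do not compute here; closure of `Frame` under the three kinds of
-- write is therefore assumed. For concrete arrays it holds by `id`.
run-fill : ∀ a e N (f : ℕ → ℕ → ℕ) (Frame : Store → Set) → 14 ≢ a → 15 ≢ a →
  (∀ {σ} → Frame σ → σ 0 0 0 ≡ N) →
  (∀ {σ} → Frame σ → σ 14 0 0 < N → σ 15 0 0 < N → ⟦ e ⟧ σ ≡ f (σ 14 0 0) (σ 15 0 0)) →
  (∀ {σ i j v} → Frame σ → Frame (update σ a i j v)) →
  (∀ {σ v} → Frame σ → Frame (update σ 14 0 0 v)) →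
  (∀ {σ v} → Frame σ → Frame (update σ 15 0 0 v)) →
  ∀ {σ} → Frame σ → Run (fill a e) σ (fillTime e N)
      (λ τ → Frame τ × (∀ {i j} → i < N → j < N → τ a i j ≡ f i j))
run-fill a e N f Frame 14≢a 15≢a bound value frame-a frame-14 frame-15 frame =
  run-for N _ Rows (λ (fr , _) → bound fr) row (frame-14 frame , λ ())
  where
  Rows : ℕ → Store → Set
  Rows i σ = Frame σ × (∀ {k l} → k < i → l < N → σ a k l ≡ f k l)
  Cells : ℕ → ℕ → Store → Set
  Cells i j σ = σ 14 0 0 ≡ i × Rows i σ × (∀ {l} → l < j → σ a i l ≡ f i l)
  row : ∀ {i σ} → i < N → σ 14 0 0 ≡ i → Rows i σ →
        Run (for 15 (var 0) (write a (var 14) (var 15) e)) σ _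
            (λ τ → τ 14 0 0 ≡ i × Rows (suc i) (update τ 14 0 0 (suc i)))
  row {i} {σ} i<N 14≡i (fr , rows) = run-map finish
      (run-for N _ (Cells i) (λ (_ , (fr , _) , _) → bound fr) cell
      (14≡i , (frame-15 fr , λ {k} {l} k<i l<N → trans (update-name σ 0 0 0 k l 15≢a) (rows k<i l<N)) , λ ()))
    where
    finish : ∀ {τ} → Cells i N τ → τ 14 0 0 ≡ i × Rows (suc i) (update τ 14 0 0 (suc i))
    finish {τ} (14≡i , (fr , rows) , cells) = 14≡i , frame-14 fr , λ {k} {l} k≤i l<N → trans
        (update-name τ 0 0 (suc i) k l 14≢a)
      (case m≤n⇒m<n∨m≡n (≤-pred k≤i) of λ { (inj₁ k<i) → rows k<i l<N ; (inj₂ refl) → cells l<N })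
    cell : ∀ {j σ} → j < N → σ 15 0 0 ≡ j → Cells i j σ →
           Run (write a (var 14) (var 15) e) σ (suc (6 + cost e))
               (λ τ → τ 15 0 0 ≡ j × Cells i (suc j) (update τ 15 0 0 (suc j)))
    cell {j} {σ} j<N refl (refl , (fr , rows) , cells) = run-write
      ( update-name σ i j v 0 0 (15≢a ∘ sym)
      , update-name σ i j v 0 0 (14≢a ∘ sym)
      , (frame-15 (frame-a {σ} {i} {j} {v} fr) , λ {k} {l} k<i l<N →
          trans (keep k l) (trans (update-row σ a {i} {j} v (<⇒≢ k<i ∘ sym)) (rows k<i l<N)))
      , λ {l} l≤j → trans (keep i l) (case m≤n⇒m<n∨m≡n (≤-pred l≤j) of λ
          { (inj₁ l<j) → trans (update-column σ a {i} {j} {i} v (<⇒≢ l<j ∘ sym)) (cells l<j)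
          ; (inj₂ refl) → trans (update-at σ a {i} {j} v refl refl) (value fr i<N j<N) }))
      where
      v = ⟦ e ⟧ σ
      keep : ∀ k l → update (update σ a i j v) 15 0 0 (suc j) a k l ≡ update σ a i j v a k l
      keep k l = update-name (update σ a i j v) 0 0 (suc j) k l 15≢a

-- Polynomial bounds

-- The base is at least 2, so coefficients are absorbed by the exponent: a constant `c` is below
-- `2 ^ c`, and doubling costs one more factor.
Polynomial : (ℕ → ℕ) → Set
Polynomial f = ∃[ d ] (∀ n → f n ≤ (2 + n) ^ d)

poly-lit : ∀ c → Polynomial (λ _ → c)
poly-lit c = c , λ n → ≤-trans (<⇒≤ (n<2^n c)) (^-monoˡ-≤ c (m≤m+n 2 n))
  where
  n<2^n : ∀ n → n < 2 ^ n
  n<2^n zero    = s≤s z≤n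
  n<2^n (suc n) = +-mono-≤ (m^n>0 2 n) (≤-trans (n<2^n n) (≤-reflexive (sym (+-identityʳ _))))

poly-id : Polynomial (λ n → n)
poly-id = 1 , λ n → ≤-trans (m≤n+m n 2) (≤-reflexive (sym (*-identityʳ (2 + n))))

infixl 6 _+ᵖ_
infixl 7 _*ᵖ_

_+ᵖ_ : ∀ {f g} → Polynomial f → Polynomial g → Polynomial (λ n → f n + g n)
(d , f≤) +ᵖ (e , g≤) = suc (d + e) , λ n → ≤-trans
  (+-mono-≤ (≤-trans (f≤ n) (^-monoʳ-≤ (2 + n) (m≤m+n d e))) (≤-trans (g≤ n) (^-monoʳ-≤ (2 + n) (m≤n+m e d))))
  (≤-trans (≤-reflexive (cong ((2 + n) ^ (d + e) +_) (sym (+-identityʳ _))))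
      (*-monoˡ-≤ ((2 + n) ^ (d + e)) (m≤m+n 2 n)))

_*ᵖ_ : ∀ {f g} → Polynomial f → Polynomial g → Polynomial (λ n → f n * g n)
(d , f≤) *ᵖ (e , g≤) = d + e , λ n → ≤-trans (*-mono-≤ (f≤ n) (g≤ n))
    (≤-reflexive (sym (^-distribˡ-+-* (2 + n) d e)))

poly-while : ∀ e {T M} → Polynomial T → Polynomial M → Polynomial (λ n → whileTime e (T n) (M n))
poly-while e T M = poly-lit _ +ᵖ M *ᵖ (poly-lit _ +ᵖ T)

poly-for : ∀ x e {T N} → Polynomial T → Polynomial N → Polynomial (λ n → forTime x e (T n) (N n))
poly-for x e T N = poly-lit 4 +ᵖ poly-while (e ⊖ var x) (T +ᵖ poly-lit 8) N

polynomial-bound : ∀ {f} → Polynomial f → ∃[ a ] ∃[ d ] (∀ n → f n ≤ a * n ^ d + a)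
polynomial-bound {f} (d , f≤) = 3 ^ d , d , λ n → ≤-trans (f≤ n) (go n)
  where
  *-^ : ∀ a b d → (a * b) ^ d ≡ a ^ d * b ^ d
  *-^ a b zero    = refl
  *-^ a b (suc d) = trans (cong (a * b *_) (*-^ a b d)) (interchange a b (a ^ d) (b ^ d))
    where
    interchange : ∀ a b x y → a * b * (x * y) ≡ a * x * (b * y)
    interchange = solve-∀
  go : ∀ n → (2 + n) ^ d ≤ 3 ^ d * n ^ d + 3 ^ d
  go zero    = ≤-trans (^-monoˡ-≤ d (s≤s (s≤s z≤n))) (m≤n+m (3 ^ d) _)
  go (suc n) = ≤-trans (^-monoˡ-≤ d (≤-trans (m≤m+n (3 + n) (n + n)) (≤-reflexive (triple n))))
                 (≤-trans (≤-reflexive (*-^ 3 (suc n) d)) (m≤m+n _ _))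
    where
    triple : ∀ n → 3 + n + (n + n) ≡ 3 * suc n
    triple = solve-∀

difference-≤ : ∀ {ℓ n k} → ℤ.+ ℓ ℤ.≤ ℤ.+ n ℤ.- ℤ.+ k → ℓ + k ≤ n
difference-≤ {ℓ} {n} {k} le = ℤ.drop‿+≤+ (subst (ℤ.+ (ℓ + k) ℤ.≤_) cancel (ℤ.+-monoˡ-≤ (ℤ.+ k) le))
  where
  cancel : ℤ.+ n ℤ.- ℤ.+ k ℤ.+ ℤ.+ k ≡ ℤ.+ n
  cancel = trans (ℤ.+-assoc (ℤ.+ n) (ℤ.- ℤ.+ k) (ℤ.+ k))
    (trans (cong (ℤ._+_ (ℤ.+ n)) (ℤ.+-inverseˡ (ℤ.+ k))) (ℤ.+-identityʳ (ℤ.+ n)))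

≤-difference : ∀ {ℓ n k} → ℓ + k ≤ n → ℤ.+ ℓ ℤ.≤ ℤ.+ n ℤ.- ℤ.+ k
≤-difference {ℓ} {n} {k} le = subst (ℤ._≤ ℤ.+ n ℤ.- ℤ.+ k) cancel (ℤ.+-monoˡ-≤ (ℤ.- ℤ.+ k) (ℤ.+≤+ le))
  where
  cancel : ℤ.+ (ℓ + k) ℤ.- ℤ.+ k ≡ ℤ.+ ℓ
  cancel = trans (ℤ.+-assoc (ℤ.+ ℓ) (ℤ.+ k) (ℤ.- ℤ.+ k))
    (trans (cong (ℤ._+_ (ℤ.+ ℓ)) (ℤ.+-inverseʳ (ℤ.+ k))) (ℤ.+-identityʳ (ℤ.+ ℓ)))

matrix-toℕ : ∀ {n} (G : Graph n) i j → matrix G (toℕ i) (toℕ j) ≡ bit (adj G i j)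
matrix-toℕ {n} G i j with toℕ i <? n | toℕ j <? n
... | yes i<n | yes j<n = cong₂ (λ i j → bit (adj G i j)) (Fin.fromℕ<-toℕ i i<n) (Fin.fromℕ<-toℕ j j<n)
... | yes _   | no j≮n  = contradiction (Fin.toℕ<n j) j≮n
... | no i≮n  | _       = contradiction (Fin.toℕ<n i) i≮n

bit-pos : ∀ {b} → 0 < bit b → b ≡ true
bit-pos {true} _ = refl

-- Arrays: 3 prices, 4 holders, 5 surviving vertices, 6 scratch matrix.
-- Scalars: 7 number of vertices that have started bidding, 8 current bidder
-- (shifted by one, 0 for none), 9 loop counter, 10 lowest price and 11 item
-- (shifted by one) found by the scan, 12 outbid holder, 13 order of the
-- kernel, 14 and 15 row and column.

scan-step : Cmd
scan-step = ifnz (read 2 (var 8 ⊖ lit 1) (var 9))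
  (ifnz (var 10 ⊖ read 3 (var 9) (lit 0))
    (10 ≔ read 3 (var 9) (lit 0) ⨾ 11 ≔ var 9 ⊕ lit 1)
    skip)
  skip

-- Holders and the current bidder share the shifted encoding, so the previous holder of the item, or
-- 0 for none, becomes the next bidder without a test. It is saved in 12 before the cell is
-- overwritten.
bid-step drop-step auction-step load-step : Cmd
bid-step =
  12 ≔ read 4 (var 11 ⊖ lit 1) (lit 0) ⨾
  write 4 (var 11 ⊖ lit 1) (lit 0) (var 8) ⨾
  write 3 (var 11 ⊖ lit 1) (lit 0) (var 10 ⊕ lit 1) ⨾
  8 ≔ var 12
drop-step =
  12 ≔ read 4 (var 8 ⊖ lit 1) (lit 0) ⨾
  write 4 (var 8 ⊖ lit 1) (lit 0) (lit 0) ⨾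
  write 3 (var 8 ⊖ lit 1) (lit 0) (var 0 ⊕ lit 2) ⨾
  8 ≔ var 12
auction-step =
  10 ≔ var 0 ⊕ lit 1 ⨾
  11 ≔ lit 0 ⨾
  for 9 (var 0) scan-step ⨾
  ifnz (var 11) bid-step drop-step
load-step = 7 ≔ var 7 ⊕ lit 1 ⨾ 8 ≔ var 7

-- The sum acts as a disjunction: some vertex has yet to start bidding, or a bidder is waiting.
auction-guard : Exp
auction-guard = var 0 ⊖ var 7 ⊕ var 8

auction : Cmd
auction = whilenz auction-guard (ifnz (var 8) auction-step load-step)

listing-step : Cmd
listing-step = ifnz (var 0 ⊕ lit 2 ⊖ read 3 (var 9) (lit 0))
  (write 5 (var 13) (lit 0) (var 9) ⨾ 13 ≔ var 13 ⊕ lit 1)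
  skip

induced-entry scratch-entry too-large : Exp
induced-entry = read 2 (read 5 (var 14) (lit 0)) (read 5 (var 15) (lit 0))
scratch-entry = read 6 (var 14) (var 15)
too-large     = var 13 ⊖ (var 1 ⊕ var 1 ⊕ var 1 ⊖ lit 3)

-- The detour through array 6 ensures that no entry of array 2 is overwritten before its last
-- reading. Both copies run over all n × n cells; those beyond the order of the kernel are junk that
-- `Outputs` does not constrain. Cell 0 changes last because it bounds the loops.
kernelize : Cmd
kernelize =
  auction ⨾
  13 ≔ lit 0 ⨾
  for 9 (var 0) listing-step ⨾
  fill 6 induced-entry ⨾
  fill 2 scratch-entry ⨾
  ifnz too-large (0 ≔ lit 0 ⨾ 1 ≔ lit 0) (0 ≔ var 13)

-- The literals are generous bounds for straight-line code of fixed cost, settled by evaluation. The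
-- bound `n * (2 + n) + n` on the rounds is the value of `measure` at the start, where all prices
-- are 0 and no vertex has bid.
scanTime auctionTime listingTime kernelizeTime : ℕ → ℕ
scanTime n      = forTime 9 (var 0) 100 n
auctionTime n   = whileTime auction-guard (300 + scanTime n) (n * (2 + n) + n)
listingTime n   = forTime 9 (var 0) 100 n
kernelizeTime n = auctionTime n + (4 + (listingTime n +
    (fillTime induced-entry n + (fillTime scratch-entry n + 100))))

kernelizeTime-polynomial : Polynomial kernelizeTime
kernelizeTime-polynomial =
  poly-while auction-guard (poly-lit 300 +ᵖ poly-for 9 (var 0) (poly-lit 100) poly-id)
             (poly-id *ᵖ (poly-lit 2 +ᵖ poly-id) +ᵖ poly-id) +ᵖ
  (poly-lit 4 +ᵖ (poly-for 9 (var 0) (poly-lit 100) poly-id +ᵖ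
    (poly-fill induced-entry +ᵖ (poly-fill scratch-entry +ᵖ poly-lit 100))))
  where
  poly-fill : ∀ e → Polynomial (fillTime e)
  poly-fill e = poly-for 14 (var 0) (poly-for 15 (var 0) (poly-lit (suc (6 + cost e))) poly-id) poly-id

-- This is `(3k)² + k`, which dominates both the matrix of a graph on `3k` vertices and the
-- parameter.
sizeBound : ℕ → ℕ
sizeBound k = k * (9 * k + 1)

-- The machine has no multiplication, so `9k + 1` is added `k` times.
sizeBound-computable : Computable sizeBound
sizeBound-computable = (for 1 (var 0) (2 ≔ var 2 ⊕ 9k+1) ⨾ 0 ≔ var 2) , λ v → case run v of λ
  { (halts {t} {τ} e _ eq) → t , τ , e , eq }
  where
  3k 9k+1 : Exp
  3k   = var 0 ⊕ var 0 ⊕ var 0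
  9k+1 = 3k ⊕ 3k ⊕ 3k ⊕ lit 1
  nine : ∀ v → (v + v + v) + (v + v + v) + (v + v + v) + 1 ≡ 9 * v + 1
  nine = solve-∀
  run : ∀ v → Run _ (inputℕ v) _ (λ τ → τ 0 0 0 ≡ sizeBound v)
  run v = run-for v 100 (λ j σ → σ 0 0 0 ≡ v × σ 2 0 0 ≡ j * (9 * v + 1)) proj₁
      (λ {j} {σ} _ 1≡j (0≡v , 2≡) → run-weaken (≤ᵇ⇒≤ _ 100 tt) (run-write (1≡j , 0≡v ,
        trans (cong₂ _+_ 2≡ (trans (cong (λ v → (v + v + v) + (v + v + v) + (v + v + v) + 1) 0≡v) (nine v)))
              (+-comm (j * (9 * v + 1)) _))))
      (refl , refl)
    then λ (_ , 2≡) → run-write 2≡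

-- Codes counted by messages

module Codes (r : ℕ) where

  q : ℕ
  q = suc (suc r)

  A : Set
  A = Fin q

  -- An index code with m messages for the subgraph induced by P; that the
  -- decoders exist is stated as the absence of confusable inputs.
  record Code {n : ℕ} (G : Graph n) (P : Fin n → Set) (m : ℕ) : Set where
    constructor _,_
    field
      encode : Vec A n → Fin m
      decodable : ∀ x y i → P i → (∀ j → P j → adj G i j ≡ true → lookup x j ≡ lookup y j) →
                  encode x ≡ encode y → lookup x i ≡ lookup y i

  open Code public

  module _ {n : ℕ} {G : Graph n} where

    code-mono : ∀ {P m m′} → m ≤ m′ → Code G P m → Code G P m′
    code-mono m≤m′ (E , ok) =
      (λ x → inject≤ (E x) m≤m′) ,
      λ x y i Pi agree eq → ok x y i Pi agree (Fin.inject≤-injective m≤m′ m≤m′ _ _ eq)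

    code-resp : ∀ {P P′ m} → (∀ {i} → P i → P′ i) → (∀ {i} → P′ i → P i) → Code G P m → Code G P′ m
    code-resp to from (E , ok) = E , λ x y i Pi agree → ok x y i (from Pi) λ j Pj → agree j (to Pj)

    -- Entries outside `P′` are set to zero before encoding. A deleted neighbour then shows the same
    -- value in any two inputs, so its loss confuses nothing.
    restrict : ∀ {P P′ m} → (∀ i → Dec (P′ i)) → (∀ i → P′ i → P i) → Code G P m → Code G P′ m
    restrict {P} {P′} P′? P′⊆P (E , ok) = E ∘ mask , ok′
      where
      entry : ∀ {i} → Dec (P′ i) → A → A
      entry (yes _) a = a
      entry (no  _) a = zero
      mask : Vec A n → Vec A n
      mask x = tabulate λ i → entry (P′? i) (lookup x i)
      lookup-mask : ∀ x i → lookup (mask x) i ≡ entry (P′? i) (lookup x i)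
      lookup-mask x = lookup∘tabulate _
      mask-∈ : ∀ x i → P′ i → lookup (mask x) i ≡ lookup x i
      mask-∈ x i P′i with P′? i | lookup-mask x i
      ... | yes _  | eq = eq
      ... | no ¬P′ | eq = contradiction P′i ¬P′
      ok′ : ∀ x y i → P′ i → (∀ j → P′ j → adj G i j ≡ true → lookup x j ≡ lookup y j) →
            E (mask x) ≡ E (mask y) → lookup x i ≡ lookup y i
      ok′ x y i P′i agree eq =
        trans (sym (mask-∈ x i P′i)) (trans (ok (mask x) (mask y) i (P′⊆P i P′i) agree′ eq) (mask-∈ y i P′i))
        where
        agree′ : ∀ j → P j → adj G i j ≡ true → lookup (mask x) j ≡ lookup (mask y) j
        agree′ j _ ij with P′? j | lookup-mask x j | lookup-mask y j
        ... | yes P′j | ex | ey = trans ex (trans (agree j P′j ij) (sym ey))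
        ... | no _    | ex | ey = trans ex (sym ey)

    private
      update-agree : ∀ (x y : Vec A n) i c {k} → (k ≢ i → lookup x k ≡ lookup y k) →
                     lookup (x [ i ]≔ c) k ≡ lookup (y [ i ]≔ c) k
      update-agree x y i c {k} agree with k Fin.≟ i
      ... | yes refl = trans (lookup∘updateAt i x) (sym (lookup∘updateAt i y))
      ... | no k≢i   = trans (lookup∘updateAt′ k i k≢i x) (trans (agree k≢i) (sym (lookup∘updateAt′ k i k≢i y)))

      -- Overwriting entry `i` by `c` forces the message into the fibre of `c`, which `ρ` renumbers.
      -- A neighbour of `i` loses no side information, as every input now carries `c` at `i`.
      fix-value : ∀ {P m m′} i (C : Code G P m) (value : Fin m → A) →
                  (∀ x → value (encode C x) ≡ lookup x i) →
                  ∀ c (ρ : ∀ z → value z ≡ c → Fin m′) → (∀ z z′ p p′ → ρ z p ≡ ρ z′ p′ → z ≡ z′) →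
                  Code G (λ j → P j × j ≢ i) m′
      fix-value i (E , ok) value value-E c ρ ρ-injective =
        (λ x → ρ (E (x [ i ]≔ c)) (trans (value-E _) (lookup∘updateAt i x))) ,
        λ x y j (Pj , j≢i) agree eq →
          trans (sym (lookup∘updateAt′ j i j≢i x))
            (trans (ok _ _ j Pj (λ k Pk jk → update-agree x y i c λ k≢i → agree k (Pk , k≢i) jk)
                       (ρ-injective _ _ _ _ eq))
                   (lookup∘updateAt′ j i j≢i y))

    -- The value at an isolated vertex i is a function of the message alone,
    -- so fixing it to its rarest value leaves at most m / q messages in use.
    abstract
      peel : ∀ {P m} i → P i → (∀ j → P j → adj G i j ≡ false) → Code G P m →
             ∃[ m′ ] (q * m′ ≤ m × Code G (λ j → P j × j ≢ i) m′)
      peel {P} {m} i Pi isolated C@(E , ok) with decoder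
        where
        decoder : Σ[ value ∈ (Fin m → A) ] (∀ x → value (E x) ≡ lookup x i)
        decoder = (λ z → value (search z)) , λ x → value-E x (search (E x))
          where
          search : ∀ z → Dec (∃ λ x → E x ≡ z)
          search z = any-vec? n λ x → E x Fin.≟ z
          value : ∀ {z} → Dec (∃ λ x → E x ≡ z) → A
          value (yes (x , _)) = lookup x i
          value (no _)        = zero
          value-E : ∀ x (found : Dec (∃ λ y → E y ≡ E x)) → value found ≡ lookup x i
          value-E x (yes (y , eq)) = ok y x i Pi
              (λ j Pj ij → contradiction (trans (sym ij) (isolated j Pj)) λ ()) eq
          value-E x (no ∄)         = contradiction (x , refl) ∄
      ... | value , value-E with smallest-fibre value
      ...   | c , m′ , qm′≤m , ρ , ρ-injective = m′ , qm′≤m , fix-value i C value value-E c ρ ρ-injective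

    add-vertex : ∀ {P m} v → Code G P m → Code G (λ i → P i ⊎ i ≡ v) (q * m)
    add-vertex {P} v (E , ok) = (λ x → combine (lookup x v) (E x)) , ok′
      where
      ok′ : ∀ x y i → P i ⊎ i ≡ v → (∀ j → P j ⊎ j ≡ v → adj G i j ≡ true → lookup x j ≡ lookup y j) →
            combine (lookup x v) (E x) ≡ combine (lookup y v) (E y) → lookup x i ≡ lookup y i
      ok′ x y i Pi agree eq with combine-injective (lookup x v) (E x) (lookup y v) (E y) eq | Pi
      ... | _  , eE | inj₁ Pi   = ok x y i Pi (λ j Pj → agree j (inj₁ Pj)) eE
      ... | ev , _  | inj₂ refl = ev

    -- One symbol serves both ends: each end sees the other and cancels it from the sum. The ends
    -- may already lie in `P`, which `exchange` exploits.
    add-edge : ∀ {P m} v w → adj G v w ≡ true → Code G P m →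
               Code G (λ i → P i ⊎ i ≡ v ⊎ i ≡ w) (q * m)
    add-edge {P} v w vw (E , ok) = (λ x → combine (lookup x v ⊞ lookup x w) (E x)) , ok′
      where
      ok′ : ∀ x y i → P i ⊎ i ≡ v ⊎ i ≡ w →
            (∀ j → P j ⊎ j ≡ v ⊎ j ≡ w → adj G i j ≡ true → lookup x j ≡ lookup y j) →
            combine (lookup x v ⊞ lookup x w) (E x) ≡ combine (lookup y v ⊞ lookup y w) (E y) →
            lookup x i ≡ lookup y i
      ok′ x y i Pi agree eq with combine-injective (lookup x v ⊞ lookup x w) (E x) (lookup y v ⊞ lookup y w)
          (E y) eq | Pi
      ... | _  , eE | inj₁ Pi          = ok x y i Pi (λ j Pj → agree j (inj₁ Pj)) eE
      ... | es , _  | inj₂ (inj₁ refl) = ⊞-cancelˡ (lookup y w)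
        (trans (⊞-comm (lookup y w) (lookup x v))
            (trans (cong (lookup x v ⊞_) (sym (agree w (inj₂ (inj₂ refl)) vw)))
            (trans es (⊞-comm (lookup y v) (lookup y w)))))
      ... | es , _  | inj₂ (inj₂ refl) = ⊞-cancelˡ (lookup y v)
        (trans (cong (_⊞ lookup x w) (sym (agree v (inj₂ (inj₁ refl)) (trans (symm G w v) vw)))) es)

    -- The zero vector and the vector with a single 1 at `i` agree on all neighbours of `i`; the
    -- second letter exists because `q` is `2 + r`.
    trivial-code : ∀ {P} i → P i → ¬ Code G P 1
    trivial-code {P} i Pi (E , ok) with trans (sym (lookup-replicate i zero)) (trans
        (ok o (o [ i ]≔ suc zero) i Pi agree (Fin-1 _ _)) (lookup∘updateAt i o))
      where
      o : Vec A n
      o = replicate n zero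
      Fin-1 : ∀ (a b : Fin 1) → a ≡ b
      Fin-1 zero zero = refl
      agree : ∀ j → P j → adj G i j ≡ true → lookup o j ≡ lookup (o [ i ]≔ suc zero) j
      agree j _ ij with j Fin.≟ i
      ... | yes refl = contradiction (trans (sym ij) (irrefl G i)) λ ()
      ... | no j≢i   = sym (lookup∘updateAt′ j i j≢i o)
    ... | ()

    -- The isolated vertices f h are all peeled off before the edges (h, f h)
    -- are added, since f h need not stay isolated once other heads are back.
    exchange : ∀ (f : Fin n → Fin n) hs {P m} → (∀ i → Dec (P i)) →
      All (λ h → adj G h (f h) ≡ true × P (f h) × (∀ j → P j → adj G (f h) j ≡ false)) hs →
      AllPairs (λ h h′ → f h ≢ f h′) hs →
      Code G P m → Code G (λ i → P i ⊎ i ∈ hs) m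
    exchange f [] P? [] [] C = code-resp inj₁ (λ { (inj₁ p) → p ; (inj₂ ()) }) C
    exchange f (h ∷ hs) {P} P? ((hf , Pf , iso) ∷ all) (new ∷ pairs) C with peel (f h) Pf iso C
    ... | m′ , le , C′ =
      restrict (λ i → P? i ⊎-dec Any.any? (i Fin.≟_) (h ∷ hs)) incl
        (code-mono le (add-edge h (f h) hf (exchange f hs (λ i → P? i ×-dec ¬? (i Fin.≟ f h)) (rest all new)
            pairs C′)))
      where
      rest : ∀ {hs} → All (λ h → adj G h (f h) ≡ true × P (f h) × (∀ j → P j → adj G (f h) j ≡ false)) hs →
             All (λ h′ → f h ≢ f h′) hs →
             All (λ h′ → adj G h′ (f h′) ≡ true × (P (f h′) × f h′ ≢ f h) ×
                 (∀ j → P j × j ≢ f h → adj G (f h′) j ≡ false)) hs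
      rest [] [] = []
      rest ((e , p , i) ∷ as) (ne ∷ nes) = (e , (p , ne ∘ sym) , λ j Pj → i j (proj₁ Pj)) ∷ rest as nes
      incl : ∀ i → P i ⊎ i ∈ (h ∷ hs) → ((P i × i ≢ f h) ⊎ i ∈ hs) ⊎ i ≡ h ⊎ i ≡ f h
      incl i (inj₁ Pi) with i Fin.≟ f h
      ... | yes eq = inj₂ (inj₂ eq)
      ... | no ne  = inj₁ (inj₁ (Pi , ne))
      incl i (inj₂ (here eq)) = inj₂ (inj₁ eq)
      incl i (inj₂ (there i∈)) = inj₁ (inj₂ i∈)

    -- Equivalence with index codes, and decidability

    -- A decoder searches for any input that produces the received word; by `decodable` all such
    -- inputs have the same entry at `i`.
    code-⊤⇒HasIndexCode : ∀ {ℓ} → Code G (λ _ → ⊤) (q ^ ℓ) → HasIndexCode A G ℓ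
    code-⊤⇒HasIndexCode {ℓ} (E , ok) = E′ , λ i → decode i , correct i
      where
      E′ : Vec A n → Vec A ℓ
      E′ x = tabulate (finToFun (E x))
      E′-injective : ∀ x y → E′ x ≡ E′ y → E x ≡ E y
      E′-injective x y eq =
        trans (sym (Fin.funToFin-finToFin {ℓ} {q} (E x)))
          (trans (funToFin-cong {ℓ} λ i → trans (sym (lookup∘tabulate (finToFun (E x)) i))
                   (trans (cong (λ v → lookup v i) eq) (lookup∘tabulate (finToFun (E y)) i)))
            (Fin.funToFin-finToFin {ℓ} {q} (E y)))
      word : ∀ i → Vec A n → Vec A (ℓ + ∣ N G i ∣)
      word i x = E′ x ++ (x ↾ N G i)
      decode : ∀ i → Vec A (ℓ + ∣ N G i ∣) → A
      decode i v with any-vec? n (λ x → Vec.≡-dec Fin._≟_ (word i x) v)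
      ... | yes (x , _) = lookup x i
      ... | no _        = zero
      correct : ∀ i x → decode i (word i x) ≡ lookup x i
      correct i x with any-vec? n (λ y → Vec.≡-dec Fin._≟_ (word i y) (word i x))
      ... | no ∄         = contradiction (x , refl) ∄
      ... | yes (y , eq) with Vec.++-injective (E′ y) (E′ x) eq
      ...   | eqE , eqN = ok y x i tt
        (λ j _ ij → ↾-injective (N G i) y x eqN j (trans (lookup-N G i j) ij)) (E′-injective y x eqE)

    HasIndexCode⇒code-⊤ : ∀ {ℓ} → HasIndexCode A G ℓ → Code G (λ _ → ⊤) (q ^ ℓ)
    HasIndexCode⇒code-⊤ {ℓ} (E , decoder) = (λ x → funToFin (lookup (E x))) , ok
      where
      ok : ∀ x y i → ⊤ → (∀ j → ⊤ → adj G i j ≡ true → lookup x j ≡ lookup y j) →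
           funToFin (lookup (E x)) ≡ funToFin (lookup (E y)) → lookup x i ≡ lookup y i
      ok x y i _ agree eq = trans (sym (proj₂ (decoder i) x))
        (trans (cong (proj₁ (decoder i)) (cong₂ _++_ eqE eqN)) (proj₂ (decoder i) y))
        where
        eqE : E x ≡ E y
        eqE = vec-ext λ j → trans (sym (finToFun-funToFin (lookup (E x)) j))
                (trans (cong (λ z → finToFun z j) eq) (finToFun-funToFin (lookup (E y)) j))
        eqN : x ↾ N G i ≡ y ↾ N G i
        eqN = ↾-cong (N G i) x y λ j j∈ → agree j tt (trans (sym (lookup-N G i j)) j∈)

    -- Encoders are enumerated as tables of length `q ^ n`, indexed by the number that codes the
    -- input.
    code? : ∀ m → Dec (Code G (λ _ → ⊤) m)
    code? m = Dec.map′ from to (any-vec? (q ^ n) λ t → ok? (λ x → lookup t (funToFin (lookup x))))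
      where
      Ok : (Vec A n → Fin m) → Set
      Ok E = ∀ x y i → (∀ j → adj G i j ≡ true → lookup x j ≡ lookup y j) →
             E x ≡ E y → lookup x i ≡ lookup y i
      ok? : ∀ E → Dec (Ok E)
      ok? E = all-vec? n λ x → all-vec? n λ y → all? λ i →
        all? (λ j → (adj G i j Bool.≟ true) →-dec (lookup x j Fin.≟ lookup y j)) →-dec
        ((E x Fin.≟ E y) →-dec (lookup x i Fin.≟ lookup y i))
      from : ∃ (λ t → Ok (λ x → lookup t (funToFin (lookup x)))) → Code G (λ _ → ⊤) m
      from (t , ok) = (λ x → lookup t (funToFin (lookup x))) , λ x y i _ agree → ok x y i λ j → agree j tt
      to : Code G (λ _ → ⊤) m → ∃ (λ t → Ok (λ x → lookup t (funToFin (lookup x))))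
      to (E , ok) = table , λ x y i agree eq →
        ok x y i tt (λ j _ → agree j) (trans (sym (lookup-table x)) (trans eq (lookup-table y)))
        where
        table : Vec (Fin m) (q ^ n)
        table = tabulate (E ∘ tabulate ∘ finToFun)
        lookup-table : ∀ x → lookup table (funToFin (lookup x)) ≡ E x
        lookup-table x = trans (lookup∘tabulate (E ∘ tabulate ∘ finToFun) (funToFin (lookup x)))
          (cong E (trans (tabulate-cong (finToFun-funToFin (lookup x))) (tabulate∘lookup x)))

    HasIndexCode? : ∀ ℓ → Dec (HasIndexCode A G ℓ)
    HasIndexCode? ℓ = Dec.map′ code-⊤⇒HasIndexCode HasIndexCode⇒code-⊤ (code? (q ^ ℓ))

    -- A positive instance must exhibit the least length, not merely some good length. It is found
    -- by testing the lengths upwards from 0, which needs `HasIndexCode?`.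
    IsInd-exists : ∀ ℓ → HasIndexCode A G ℓ → ∃[ ℓ′ ] (ℓ′ ≤ ℓ × IsInd q G ℓ′)
    IsInd-exists ℓ C = go ℓ 0 (+-identityʳ ℓ) λ _ _ → z≤n
      where
      go : ∀ fuel b → fuel + b ≡ ℓ → (∀ ℓ′ → HasIndexCode A G ℓ′ → b ≤ ℓ′) →
           ∃[ ℓ′ ] (ℓ′ ≤ ℓ × IsInd q G ℓ′)
      go zero b refl low = b , ≤-refl , C , low
      go (suc fuel) b eq low with HasIndexCode? b
      ... | yes C′ = b , m+n≤o⇒n≤o (suc fuel) (≤-reflexive eq) , C′ , low
      ... | no ¬C  = go fuel (suc b) (trans (+-suc fuel b) eq)
        λ ℓ′ C′ → ≤∧≢⇒< (low ℓ′ C′) λ { refl → ¬C C′ }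

    -- Matchings and the symbols they save

    infix 4 _∈?_
    _∈?_ : ∀ (i : Fin n) xs → Dec (i ∈ xs)
    i ∈? xs = Any.any? (i Fin.≟_) xs

    remove : ∀ {v : Fin n} {xs} → v ∈ xs →
             ∃[ ys ] (length xs ≡ suc (length ys) × (∀ {i} → i ∈ xs → i ≡ v ⊎ i ∈ ys))
    remove {xs = _ ∷ xs} (here refl) = xs , refl , λ { (here eq) → inj₁ eq ; (there i∈) → inj₂ i∈ }
    remove {xs = x ∷ _} (there v∈) with remove v∈
    ... | ys , len , split = x ∷ ys , cong suc len , λ
      { (here eq) → inj₂ (here eq)
      ; (there i∈) → Sum.map₂ there (split i∈) }

    complement : ∀ (xs : List (Fin n)) → Unique xs →
                 ∃[ ys ] (length ys + length xs ≡ n × (∀ i → i ∈ xs ⊎ i ∈ ys))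
    complement [] [] = allFin n , trans (+-identityʳ _) (length-tabulate _) , λ i → inj₂ (∈-allFin i)
    complement (x ∷ xs) (x∉ ∷ u) with complement xs u
    ... | ys , len , cover with cover x
    ...   | inj₁ x∈xs = contradiction refl (All.lookup x∉ x∈xs)
    ...   | inj₂ x∈ys with remove x∈ys
    ...     | zs , lenz , split = zs ,
      trans (+-suc _ _) (trans (cong (_+ length xs) (sym lenz)) len) ,
      λ i → case cover i of λ
        { (inj₁ i∈) → inj₁ (there i∈)
        ; (inj₂ i∈) → case split i∈ of λ { (inj₁ eq) → inj₁ (here eq) ; (inj₂ i∈z) → inj₂ i∈z } }

    add-vertices : ∀ xs {P m} → Code G P m → Code G (λ i → P i ⊎ i ∈ xs) (q ^ length xs * m)
    add-vertices [] {P} {m} C = code-mono (≤-reflexive (sym (*-identityˡ m)))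
      (code-resp inj₁ (λ { (inj₁ p) → p ; (inj₂ ()) }) C)
    add-vertices (v ∷ xs) {P} {m} C =
      code-resp from to (code-mono (≤-reflexive (sym (*-assoc q (q ^ length xs) m)))
          (add-vertex v (add-vertices xs C)))
      where
      to : ∀ {i} → P i ⊎ i ∈ (v ∷ xs) → (P i ⊎ i ∈ xs) ⊎ i ≡ v
      to (inj₁ p) = inj₁ (inj₁ p)
      to (inj₂ (here eq)) = inj₂ eq
      to (inj₂ (there i∈)) = inj₁ (inj₂ i∈)
      from : ∀ {i} → (P i ⊎ i ∈ xs) ⊎ i ≡ v → P i ⊎ i ∈ (v ∷ xs)
      from (inj₁ (inj₁ p)) = inj₁ p
      from (inj₁ (inj₂ i∈)) = inj₂ (there i∈)
      from (inj₂ eq) = inj₂ (here eq)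

    -- The `s` pairs take one symbol each and the other `n - 2s` vertices are sent in full, which
    -- makes `n - s` symbols.
    matching-saving : ∀ xs s → Unique xs → length xs ≡ s + s → Code G (_∈ xs) (q ^ s) →
                      ∃[ ℓ ] (ℓ + s ≡ n × Code G (λ _ → ⊤) (q ^ ℓ))
    matching-saving xs s uniq len C with complement xs uniq
    ... | ys , len′ , cover = length ys + s ,
      trans (+-assoc (length ys) s s) (trans (cong (length ys +_) (sym len)) len′) ,
      code-resp (λ _ → tt) (λ {i} _ → cover i)
        (code-mono (≤-reflexive (sym (^-distribˡ-+-* q (length ys) s))) (add-vertices ys C))

    -- The greedy matching carries its code along. The fuel cannot run out, for then `xs` would list
    -- more than `n` distinct vertices.
    maximal-matching : ∃[ xs ] ∃[ s ] (Unique xs × length xs ≡ s + s × Code G (_∈ xs) (q ^ s) ×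
                         (∀ a b → a ∉ xs → b ∉ xs → adj G a b ≡ false))
    maximal-matching = go (suc n) [] 0 [] refl ((λ _ → zero) , λ x y i ()) (m≤m+n (suc n) 0)
      where
      go : ∀ fuel xs s → Unique xs → length xs ≡ s + s → Code G (_∈ xs) (q ^ s) → n < fuel + length xs →
           ∃[ xs ] ∃[ s ] (Unique xs × length xs ≡ s + s × Code G (_∈ xs) (q ^ s) ×
             (∀ a b → a ∉ xs → b ∉ xs → adj G a b ≡ false))
      go zero xs s uniq len C n<len with complement xs uniq
      ... | ys , eq , _ = contradiction (≤-trans (m≤n+m (length xs) (length ys)) (≤-reflexive eq)) (<⇒≱ n<len)
      go (suc fuel) xs s uniq len C n<len
        with any? (λ a → any? λ b → ¬? (a ∈? xs) ×-dec ¬? (b ∈? xs) ×-dec (adj G a b Bool.≟ true))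
      ... | no ∄ = xs , s , uniq , len , C , λ a b a∉ b∉ → Bool.¬-not λ ab → ∄ (a , b , a∉ , b∉ , ab)
      ... | yes (a , b , a∉ , b∉ , ab) = go fuel (a ∷ b ∷ xs) (suc s)
        ((a≢b ∷ All.¬Any⇒All¬ xs a∉) ∷ All.¬Any⇒All¬ xs b∉ ∷ uniq)
        (cong suc (trans (cong suc len) (sym (+-suc s s))))
        (code-resp to from (add-edge a b ab C))
        (≤-trans n<len (≤-trans (n≤1+n _) (≤-reflexive (sym (trans (+-suc fuel _) (cong suc (+-suc fuel _)))))))
        where
        a≢b : a ≢ b
        a≢b refl = contradiction (trans (sym ab) (irrefl G a)) λ ()
        to : ∀ {i} → i ∈ xs ⊎ i ≡ a ⊎ i ≡ b → i ∈ (a ∷ b ∷ xs)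
        to (inj₁ i∈)          = there (there i∈)
        to (inj₂ (inj₁ refl)) = here refl
        to (inj₂ (inj₂ refl)) = there (here refl)
        from : ∀ {i} → i ∈ (a ∷ b ∷ xs) → i ∈ xs ⊎ i ≡ a ⊎ i ≡ b
        from (here eq)          = inj₂ (inj₁ eq)
        from (there (here eq))  = inj₂ (inj₂ eq)
        from (there (there i∈)) = inj₁ i∈

    module _ (τ : Fin n → Fin n) (τ-injective : ∀ {a b} → τ a ≡ τ b → a ≡ b)
             (τ-adj : ∀ a → adj G a (τ a) ≡ true) where

      private
        pairs : List (Fin n) → List (Fin n)
        pairs []       = []
        pairs (a ∷ us) = a ∷ τ a ∷ pairs us

        length-pairs : ∀ us → length (pairs us) ≡ length us + length us
        length-pairs []       = refl
        length-pairs (a ∷ us) = cong suc (trans (cong suc (length-pairs us)) (sym (+-suc _ _)))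

        ∈-pairs : ∀ {i} us → i ∈ pairs us → i ∈ us ⊎ ∃[ b ] (b ∈ us × i ≡ τ b)
        ∈-pairs (a ∷ us) (here eq)          = inj₁ (here eq)
        ∈-pairs (a ∷ us) (there (here eq))  = inj₂ (a , here refl , eq)
        ∈-pairs (a ∷ us) (there (there i∈)) with ∈-pairs us i∈
        ... | inj₁ i∈us          = inj₁ (there i∈us)
        ... | inj₂ (b , b∈ , eq) = inj₂ (b , there b∈ , eq)

        -- As `us` is independent and `a` is adjacent to `τ a`, no `τ a` lies in `us`; the images
        -- are distinct by injectivity.
        pairs-unique : ∀ us → Unique us → (∀ {a b} → a ∈ us → b ∈ us → adj G a b ≡ false) → Unique (pairs us)
        pairs-unique []       []          indep = []
        pairs-unique (a ∷ us) (a∉ ∷ uniq) indep =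
          (a≢τa ∷ All.¬Any⇒All¬ _ a∉pairs) ∷ All.¬Any⇒All¬ _ τa∉pairs ∷
          pairs-unique us uniq λ a∈ b∈ → indep (there a∈) (there b∈)
          where
          clash : ∀ {a b} → a ∈ (_ ∷ us) → b ∈ (_ ∷ us) → b ≢ τ a
          clash {a} a∈ b∈ refl = contradiction (trans (sym (τ-adj a)) (indep a∈ b∈)) λ ()
          a≢τa : a ≢ τ a
          a≢τa = clash (here refl) (here refl)
          a∉pairs : a ∉ pairs us
          a∉pairs a∈ with ∈-pairs us a∈
          ... | inj₁ a∈us          = All.lookup a∉ a∈us refl
          ... | inj₂ (b , b∈ , eq) = clash (there b∈) (here refl) eq
          τa∉pairs : τ a ∉ pairs us
          τa∉pairs τa∈ with ∈-pairs us τa∈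
          ... | inj₁ τa∈us         = clash (here refl) (there τa∈us) refl
          ... | inj₂ (b , b∈ , eq) = All.lookup a∉ b∈ (τ-injective eq)

        pairs-code : ∀ us → Code G (_∈ pairs us) (q ^ length us)
        pairs-code []       = (λ _ → zero) , λ x y i ()
        pairs-code (a ∷ us) = code-resp to from (add-edge a (τ a) (τ-adj a) (pairs-code us))
          where
          to : ∀ {i} → i ∈ pairs us ⊎ i ≡ a ⊎ i ≡ τ a → i ∈ pairs (a ∷ us)
          to (inj₁ i∈)          = there (there i∈)
          to (inj₂ (inj₁ refl)) = here refl
          to (inj₂ (inj₂ refl)) = there (here refl)
          from : ∀ {i} → i ∈ pairs (a ∷ us) → i ∈ pairs us ⊎ i ≡ a ⊎ i ≡ τ a
          from (here eq)          = inj₂ (inj₁ eq)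
          from (there (here eq))  = inj₂ (inj₂ eq)
          from (there (there i∈)) = inj₁ i∈

      -- The vertices missed by a maximal matching are independent, so τ
      -- matches them into the matched ones; one of the two matchings has at
      -- least n / 3 edges.
      third-saving : ∃[ s ] ∃[ ℓ ] (n ≤ 3 * s × ℓ + s ≡ n × Code G (λ _ → ⊤) (q ^ ℓ))
      third-saving with maximal-matching
      ... | xs , s , uniq , len , C , maximal = choose (≤-total t s)
        where
        us : List (Fin n)
        us = filter (λ i → ¬? (i ∈? xs)) (allFin n)
        t : ℕ
        t = length us
        ∈us⇒∉xs : ∀ {i} → i ∈ us → i ∉ xs
        ∈us⇒∉xs i∈ = proj₂ (∈-filter⁻ (λ i → ¬? (i ∈? xs)) {xs = allFin n} i∈)
        cover : ∀ i → i ∈ xs List.++ us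
        cover i with i ∈? xs
        ... | yes i∈ = ∈-++⁺ˡ i∈
        ... | no i∉  = ∈-++⁺ʳ xs (∈-filter⁺ (λ i → ¬? (i ∈? xs)) (∈-allFin i) i∉)
        n≤s+s+t : n ≤ s + s + t
        n≤s+s+t = subst (n ≤_) (trans (length-++ xs) (cong (_+ t) len))
          (injective⇒≤ {f = λ i → Any.index (cover i)} λ {i} {j} eq →
            trans (lookup-index (cover i)) (trans (cong (List.lookup (xs List.++ us)) eq)
                (sym (lookup-index (cover j)))))
        choose : t ≤ s ⊎ s ≤ t → ∃[ s ] ∃[ ℓ ] (n ≤ 3 * s × ℓ + s ≡ n × Code G (λ _ → ⊤) (q ^ ℓ))
        choose (inj₁ t≤s) with matching-saving xs s uniq len C
        ... | ℓ , eq , C′ = s , ℓ , ≤-trans n≤s+s+t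
            (≤-trans (+-monoʳ-≤ (s + s) t≤s) (≤-reflexive (triple s))) , eq , C′
          where
          triple : ∀ s → s + s + s ≡ 3 * s
          triple = solve-∀
        choose (inj₂ s≤t) with matching-saving (pairs us) t
          (pairs-unique us (filter⁺ (λ i → ¬? (i ∈? xs)) (allFin⁺ n)) λ a∈ b∈ → maximal _ _ (∈us⇒∉xs a∈)
              (∈us⇒∉xs b∈))
          (length-pairs us) (pairs-code us)
        ... | ℓ , eq , C′ = t , ℓ , ≤-trans n≤s+s+t
            (≤-trans (+-monoˡ-≤ t (+-mono-≤ s≤t s≤t)) (≤-reflexive (triple t))) , eq , C′
          where
          triple : ∀ s → s + s + s ≡ 3 * s
          triple = solve-∀

    -- S = {u} ∪ f(R) violates Hall's condition in the bipartite double cover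
    -- of G[P].  Then S \ R is independent with all its neighbours in R \ S,
    -- and f maps R \ S into S \ (R ∪ {u}): the set S ∩ R is mapped to itself
    -- by f, hence (being finite) onto itself.
    surplus-vertex : ∀ {P R : Fin n → Set} (P? : ∀ i → Dec (P i)) (R? : ∀ i → Dec (R i))
      (f : Fin n → Fin n) u → P u →
      (∀ h → R h → adj G h (f h) ≡ true × P (f h) × f h ≢ u) →
      (∀ h h′ → R h → R h′ → f h ≡ f h′ → h ≡ h′) →
      (∀ j → P j → adj G u j ≡ true → R j) →
      (∀ h → R h → ∀ j → P j → adj G (f h) j ≡ true → R j) →
      ∀ {m} → Code G P m → ∃[ m′ ] (q * m′ ≤ m × Code G (λ i → P i × i ≢ u) m′)
    surplus-vertex {P} {R} P? R? f u Pu fR f-inj Nu Nf C =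
      -- Deleting the heads `H` isolates `S` minus `R`, so `u` can be peeled at the gain of a factor
      -- `q`; `exchange` then returns `H` with no further messages.
      refill (peel u (Pu , λ (_ , u∉S) → u∉S (inj₁ refl))
          (λ j (Pj , j∉H) → isolated u Pu (inj₁ refl) u∉R j (Pj , j∉H))
                   (restrict (λ i → P? i ×-dec ¬? (H? i)) (λ _ → proj₁) C))
      where
      S H D : Fin n → Set
      S s = s ≡ u ⊎ ∃ λ h → R h × s ≡ f h
      H h = R h × ¬ S h
      D d = S d × R d
      S? : ∀ s → Dec (S s)
      S? s = (s Fin.≟ u) ⊎-dec any? λ h → R? h ×-dec (s Fin.≟ f h)
      H? : ∀ h → Dec (H h)
      H? h = R? h ×-dec ¬? (S? h)
      N-S : ∀ {s} → S s → ∀ j → P j → adj G s j ≡ true → R j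
      N-S (inj₁ refl)            = Nu
      N-S (inj₂ (h , Rh , refl)) = Nf h Rh
      D-closed : ∀ {d} → D d → D (f d)
      D-closed {d} (Sd , Rd) = inj₂ (d , Rd , refl) , N-S Sd (f d) (proj₁ (proj₂ (fR d Rd))) (proj₁ (fR d Rd))
      -- Continuing `f` by the identity off `D` gives an injection of the whole finite vertex set,
      -- hence a surjection.
      extend : ∀ {x} → Dec (D x) → Fin n
      extend {x} (yes _) = f x
      extend {x} (no _)  = x
      extend-injective : ∀ {x y} (x? : Dec (D x)) (y? : Dec (D y)) → extend x? ≡ extend y? → x ≡ y
      extend-injective (yes Dx) (yes Dy) eq   = f-inj _ _ (proj₂ Dx) (proj₂ Dy) eq
      extend-injective (yes Dx) (no ¬Dy) refl = contradiction (D-closed Dx) ¬Dy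
      extend-injective (no ¬Dx) (yes Dy) refl = contradiction (D-closed Dy) ¬Dx
      extend-injective (no _)   (no _)   eq   = eq
      D? : ∀ d → Dec (D d)
      D? d = S? d ×-dec R? d
      D-onto : ∀ {d} → D d → ∃[ x ] (D x × d ≡ f x)
      D-onto {d} Dd with injective⇒surjective (extend ∘ D?) (extend-injective (D? _) (D? _)) d
      ... | x , eq with D? x
      ...   | yes Dx = x , Dx , sym eq
      ...   | no ¬Dx = contradiction (subst D (sym eq) Dd) ¬Dx
      -- Otherwise `u` would lie in `D` and so be a value of `f`, which avoids `u`.
      u∉R : ¬ R u
      u∉R Ru with D-onto (inj₁ refl , Ru)
      ... | x , Dx , eq = proj₂ (proj₂ (fR x (proj₂ Dx))) (sym eq)
      -- If `f h` were in `R`, it would have a preimage in `D`; by injectivity that is `h`, which is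
      -- outside `S`.
      f-H : ∀ {h} → H h → ¬ R (f h)
      f-H {h} (Rh , h∉S) Rfh with D-onto (inj₂ (h , Rh , refl) , Rfh)
      ... | x , (Sx , Rx) , eq = h∉S (subst S (sym (f-inj h x Rh Rx eq)) Sx)
      -- A neighbour `j` of `i` lies in `R`. Were it also in `S`, the same rule applied to the edge
      -- from `j` to `i` would put `i` in `R`; so `j` belongs to the deleted `H`.
      isolated : ∀ i → P i → S i → ¬ R i → ∀ j → P j × ¬ H j → adj G i j ≡ false
      isolated i Pi Si i∉R j (Pj , j∉H) = Bool.¬-not λ ij → j∉H (N-S Si j Pj ij , λ Sj →
        i∉R (N-S Sj i Pi (trans (symm G j i) ij)))
      hs : List (Fin n)
      hs = filter H? (allFin n)
      hs⊆H : All H hs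
      hs⊆H = all-filter H? (allFin n)
      tail : ∀ {h} → H h → adj G h (f h) ≡ true × ((P (f h) × ¬ H (f h)) × f h ≢ u) ×
             (∀ j → (P j × ¬ H j) × j ≢ u → adj G (f h) j ≡ false)
      tail {h} Hh@(Rh , _) with fR h Rh
      ... | hf , Pf , f≢u = hf , ((Pf , f-H Hh ∘ proj₁) , f≢u) ,
        λ j Pj → isolated (f h) Pf (inj₂ (h , Rh , refl)) (f-H Hh) j (proj₁ Pj)
      distinct : ∀ {hs} → All H hs → Unique hs → AllPairs (λ h h′ → f h ≢ f h′) hs
      distinct [] [] = []
      distinct ((Rh , _) ∷ Hs) (h∉ ∷ uniq) =
        All.zipWith (λ (h≢ , (Rh′ , _)) eq → h≢ (f-inj _ _ Rh Rh′ eq)) (h∉ , Hs) ∷ distinct Hs uniq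
      split : ∀ i → P i × i ≢ u → ((P i × ¬ H i) × i ≢ u) ⊎ i ∈ hs
      split i (Pi , i≢u) with H? i
      ... | yes Hi = inj₂ (∈-filter⁺ H? (∈-allFin i) Hi)
      ... | no ¬Hi = inj₁ ((Pi , ¬Hi) , i≢u)
      refill : ∀ {m} → ∃[ m′ ] (q * m′ ≤ m × Code G (λ j → (P j × ¬ H j) × j ≢ u) m′) →
               ∃[ m′ ] (q * m′ ≤ m × Code G (λ i → P i × i ≢ u) m′)
      refill (m′ , qm′≤m , C′) = m′ , qm′≤m ,
        restrict (λ i → P? i ×-dec ¬? (i Fin.≟ u)) split
          (exchange f hs (λ i → (P? i ×-dec ¬? (H? i)) ×-dec ¬? (i Fin.≟ u))
            (All.map tail hs⊆H) (distinct hs⊆H (filter⁺ H? (allFin⁺ n))) C′)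

  -- Transfer of codes along an induced embedding

  module _ {c n : ℕ} {G′ : Graph c} {G : Graph n} (ι : Fin c → Fin n)
           (ι-injective : ∀ {a b} → ι a ≡ ι b → a ≡ b)
           (ι-adj : ∀ a b → adj G′ a b ≡ adj G (ι a) (ι b))
           {P : Fin n → Set} (ι-P : ∀ a → P (ι a)) (ι-onto : ∀ {v} → P v → ∃[ a ] ι a ≡ v) where

    code-from-induced : ∀ {m} → Code G′ (λ _ → ⊤) m → Code G P m
    code-from-induced {m} (E , ok) = (λ x → E (pull x)) , ok′
      where
      pull : Vec A n → Vec A c
      pull x = tabulate λ a → lookup x (ι a)
      lookup-pull : ∀ x a → lookup (pull x) a ≡ lookup x (ι a)
      lookup-pull x = lookup∘tabulate λ a → lookup x (ι a)
      ok′ : ∀ x y i → P i → (∀ j → P j → adj G i j ≡ true → lookup x j ≡ lookup y j) →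
            E (pull x) ≡ E (pull y) → lookup x i ≡ lookup y i
      ok′ x y i Pi agree eq with ι-onto Pi
      ... | a , refl = trans (sym (lookup-pull x a)) (trans (ok (pull x) (pull y) a tt
        (λ b _ ab → trans (lookup-pull x b) (trans (agree (ι b) (ι-P b) (trans (sym (ι-adj a b)) ab))
            (sym (lookup-pull y b)))) eq)
        (lookup-pull y a))

    code-to-induced : ∀ {m} → Code G P m → Code G′ (λ _ → ⊤) m
    code-to-induced {m} (E , ok) = (λ y → E (push y)) , ok′
      where
      preimage? : ∀ v → Dec (∃[ a ] ι a ≡ v)
      preimage? v = any? λ a → ι a Fin.≟ v
      entry : ∀ {v} → Vec A c → Dec (∃[ a ] ι a ≡ v) → A
      entry y (yes (a , _)) = lookup y a
      entry y (no _)        = zero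
      push : Vec A c → Vec A n
      push y = tabulate λ v → entry y (preimage? v)
      lookup-push : ∀ y a → lookup (push y) (ι a) ≡ lookup y a
      lookup-push y a = trans (lookup∘tabulate (λ v → entry y (preimage? v)) (ι a)) (entry-ι (preimage? (ι a)))
        where
        entry-ι : (a? : Dec (∃[ b ] ι b ≡ ι a)) → entry y a? ≡ lookup y a
        entry-ι (yes (b , eq)) = cong (lookup y) (ι-injective eq)
        entry-ι (no ∄)         = contradiction (a , refl) ∄
      ok′ : ∀ x y a → ⊤ → (∀ b → ⊤ → adj G′ a b ≡ true → lookup x b ≡ lookup y b) →
            E (push x) ≡ E (push y) → lookup x a ≡ lookup y a
      ok′ x y a _ agree eq = trans (sym (lookup-push x a))
          (trans (ok (push x) (push y) (ι a) (ι-P a) agree′ eq) (lookup-push y a))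
        where
        agree′ : ∀ j → P j → adj G (ι a) j ≡ true → lookup (push x) j ≡ lookup (push y) j
        agree′ j Pj aj with ι-onto Pj
        ... | b , refl = trans (lookup-push x b)
            (trans (agree b tt (trans (ι-adj a b) aj)) (sym (lookup-push y b)))

  empty-graph : Graph 0
  empty-graph = record { adj = λ () ; irrefl = λ () ; symm = λ () }

  -- The constant positive answer; its order 0 meets the size bound because `3 * 0 ∸ 3` is 0.
  empty-yes : DualIndexCoding q (instance-of empty-graph 0)
  empty-yes = 0 , (((λ _ → []) , λ ()) , λ _ _ → z≤n) , ℤ.+≤+ z≤n

  -- Every vertex v plays two roles, as an item with price p v and as a bidder
  -- for one of its neighbours; m v is 0 or suc (the bidder holding item v).
  -- The price 2 + n marks the vertices that have been deleted.
  module Auction {n : ℕ} (G : Graph n) where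

    -- Invariants of the auction

    Alive : (ℕ → ℕ) → Fin n → Set
    Alive p v = p (toℕ v) < 2 + n

    Alive? : ∀ p v → Dec (Alive p v)
    Alive? p v = p (toℕ v) <? 2 + n

    Holds : (ℕ → ℕ) → Fin n → Fin n → Set
    Holds m h s = m (toℕ h) ≡ suc (toℕ s)

    potential : (ℕ → ℕ) → ℕ
    potential p = sumTo (λ v → 2 + n ∸ p v) n

    -- The remainder `2 + n ∸ p v` is also what `listing-step` tests, so this count follows the
    -- program.
    alive-count : (ℕ → ℕ) → ℕ → ℕ
    alive-count p = sumTo λ v → sgn (2 + n ∸ p v)

    record Invariant (p m : ℕ → ℕ) (cur i : ℕ) : Set where
      field
        i≤n       : i ≤ n
        m-wf      : ∀ h → m (toℕ h) ≡ 0 ⊎ ∃[ s ] Holds m h s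
        -- An item that has received a bid is never released while it survives; this supplies the
        -- holders of the items above the gap.
        priced    : ∀ {h} → Alive p h → 0 < p (toℕ h) → ∃[ s ] Holds m h s
        h-alive   : ∀ {h s} → Holds m h s → Alive p h
        s-alive   : ∀ {h s} → Holds m h s → Alive p s
        s-adj     : ∀ {h s} → Holds m h s → adj G s h ≡ true
        s-loaded  : ∀ {h s} → Holds m h s → toℕ s < i
        s-passive : ∀ {h s} → Holds m h s → cur ≢ suc (toℕ s)
        injective : ∀ {h h′ s} → Holds m h s → Holds m h′ s → h ≡ h′
        slack     : ∀ {h s} → Holds m h s → ∀ j → adj G s j ≡ true → p (toℕ h) ≤ suc (p (toℕ j))
        served    : ∀ {s} → Alive p s → toℕ s < i → cur ≡ suc (toℕ s) ⊎ ∃[ h ] Holds m h s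
        cur-alive : ∀ {u : Fin n} → cur ≡ suc (toℕ u) → Alive p u
        cur-wf    : cur ≡ 0 ⊎ Σ[ u ∈ Fin n ] (cur ≡ suc (toℕ u) × toℕ u < i)
        -- Only a bidder is ever deleted, so a vertex is still present when its turn to start
        -- bidding comes.
        fresh     : ∀ v → i ≤ toℕ v → Alive p v

    -- By `deleted≤` every length attained for `G` has the form `deleted + ℓ`, so that `shrink`
    -- applies to it.
    record Reduction (p : ℕ → ℕ) : Set where
      field
        deleted  : ℕ
        count    : alive-count p n + deleted ≡ n
        shrink   : ∀ ℓ → Code G (λ _ → ⊤) (q ^ (deleted + ℓ)) → Code G (Alive p) (q ^ ℓ)
        grow     : ∀ ℓ → Code G (Alive p) (q ^ ℓ) → Code G (λ _ → ⊤) (q ^ (deleted + ℓ))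
        deleted≤ : ∀ ℓ → Code G (λ _ → ⊤) (q ^ ℓ) → deleted ≤ ℓ

    private
      ≢toℕ : ∀ {i j : Fin n} → i ≢ j → toℕ i ≢ toℕ j
      ≢toℕ i≢j = i≢j ∘ Fin.toℕ-injective

    -- The `n` items cannot occupy all `n + 1` levels from 0 to `n`.
    price-gap : ∀ (p : ℕ → ℕ) → ∃[ t ] (t ≤ n × (∀ v → p (toℕ {n} v) ≢ t))
    price-gap p with any? {n = suc n} (λ t → all? {n = n} λ v → ¬? (p (toℕ v) ≟ toℕ t))
    ... | yes (t , free) = toℕ t , ≤-pred (Fin.toℕ<n t) , free
    ... | no ∄ = contradiction (injective⇒≤ {f = λ t → proj₁ (hit t)} λ {t} {t′} eq →
        Fin.toℕ-injective (trans (sym (proj₂ (hit t))) (trans (cong (p ∘ toℕ) eq) (proj₂ (hit t′))))) 1+n≰n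
      where
      hit : ∀ (t : Fin (suc n)) → ∃[ v ] p (toℕ {n} v) ≡ toℕ t
      hit t with any? (λ v → p (toℕ v) ≟ toℕ t)
      ... | yes h = h
      ... | no ¬h = contradiction (t , λ v eq → ¬h (v , eq)) ∄

    initial : ∀ {p m} → (∀ v → p v ≡ 0) → (∀ v → m v ≡ 0) → Invariant p m 0 0
    initial {p} {m} p≡0 m≡0 = record
      { i≤n = z≤n
      ; m-wf = λ h → inj₁ (m≡0 (toℕ h))
      ; priced = λ {h} _ 0<p → contradiction (sym (p≡0 (toℕ h))) (<⇒≢ 0<p)
      ; h-alive = λ H → none H
      ; s-alive = λ H → none H
      ; s-adj = λ H → none H
      ; s-loaded = λ H → none H
      ; s-passive = λ H → none H
      ; injective = λ H → none H
      ; slack = λ H → none H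
      ; served = λ _ ()
      ; cur-alive = λ ()
      ; cur-wf = inj₁ refl
      ; fresh = λ v _ → subst (_< 2 + n) (sym (p≡0 (toℕ v))) (s≤s z≤n)
      }
      where
      none : ∀ {h s} {W : Set} → Holds m h s → W
      none {h} H with trans (sym (m≡0 (toℕ h))) H
      ... | ()

    initial-reduction : ∀ {p} → (∀ v → p v ≡ 0) → Reduction p
    initial-reduction {p} p≡0 = record
      { deleted = 0
      ; count = trans (+-identityʳ _) (ones n)
      ; shrink = λ ℓ → code-resp {P = λ _ → ⊤} {P′ = Alive p} (λ {v} _ → alive v) (λ _ → tt)
      ; grow = λ ℓ → code-resp {P = Alive p} {P′ = λ _ → ⊤} (λ _ → tt) (λ {v} _ → alive v)
      ; deleted≤ = λ _ _ → z≤n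
      }
      where
      alive : ∀ v → Alive p v
      alive v = subst (_< 2 + n) (sym (p≡0 (toℕ v))) (s≤s z≤n)
      ones : ∀ k → alive-count p k ≡ k
      ones zero    = refl
      ones (suc k) = trans (cong₂ _+_ (ones k) (cong (λ x → sgn (2 + n ∸ x)) (p≡0 k))) (+-comm k 1)

    load : ∀ {p m i} → i < n → Invariant p m 0 i → Invariant p m (suc i) (suc i)
    load {p} {m} {i} i<n I = record
      { i≤n = i<n
      ; m-wf = m-wf
      ; priced = priced
      ; h-alive = h-alive
      ; s-alive = s-alive
      ; s-adj = s-adj
      ; s-loaded = λ H → m<n⇒m<1+n (s-loaded H)
      ; s-passive = λ H eq → <⇒≢ (s-loaded H) (sym (suc-injective eq))
      ; injective = injective
      ; slack = slack
      ; served = served′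
      ; cur-alive = λ {u} eq → fresh u (≤-reflexive (suc-injective eq))
      ; cur-wf = inj₂ (fromℕ< i<n , cong suc (sym (Fin.toℕ-fromℕ< i<n)) , ≤-reflexive
          (cong suc (Fin.toℕ-fromℕ< i<n)))
      ; fresh = λ v i<v → fresh v (<⇒≤ i<v)
      }
      where
      open Invariant I
      served′ : ∀ {s} → Alive p s → toℕ s < suc i → suc i ≡ suc (toℕ s) ⊎ ∃[ h ] Holds m h s
      served′ as s≤i with m≤n⇒m<n∨m≡n (≤-pred s≤i)
      ... | inj₂ eq = inj₁ (cong suc (sym eq))
      ... | inj₁ s<i with served as s<i
      ...   | inj₂ H = inj₂ H
      ...   | inj₁ ()

    -- A single bid and a single deletion

    module _ {p m p′ m′ : ℕ → ℕ} {cur i : ℕ} {u : Fin n} (I : Invariant p m cur i)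
        (cur≡u : cur ≡ suc (toℕ u)) where

      open Invariant I

      module Bid {h : Fin n} (uh : adj G u h ≡ true) (cheap : p (toℕ h) ≤ n)
                 (minimal : ∀ j → adj G u j ≡ true → p (toℕ h) ≤ p (toℕ j))
                 (p′-h : p′ (toℕ h) ≡ suc (p (toℕ h))) (p′-other : ∀ v → v ≢ toℕ h → p′ v ≡ p v)
                 (m′-h : m′ (toℕ h) ≡ cur) (m′-other : ∀ v → v ≢ toℕ h → m′ v ≡ m v) where

        private
          h-alive′ : Alive p′ h
          h-alive′ = subst (_< 2 + n) (sym p′-h) (s≤s (s≤s cheap))

          alive-to : ∀ {v} → Alive p v → Alive p′ v
          alive-to {v} a with v Fin.≟ h
          ... | yes refl = h-alive′
          ... | no v≢h   = subst (_< 2 + n) (sym (p′-other (toℕ v) (≢toℕ v≢h))) a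

          alive-from : ∀ {v} → Alive p′ v → Alive p v
          alive-from {v} a with v Fin.≟ h
          ... | yes refl = s≤s (m≤n⇒m≤1+n cheap)
          ... | no v≢h   = subst (_< 2 + n) (p′-other (toℕ v) (≢toℕ v≢h)) a

          p≤p′ : ∀ v → p (toℕ v) ≤ p′ (toℕ {n} v)
          p≤p′ v with v Fin.≟ h
          ... | yes refl = subst (p (toℕ h) ≤_) (sym p′-h) (n≤1+n _)
          ... | no v≢h   = ≤-reflexive (sym (p′-other (toℕ v) (≢toℕ v≢h)))

          holds′-h : Holds m′ h u
          holds′-h = trans m′-h cur≡u

          holds′-other : ∀ {v s} → v ≢ h → Holds m v s → Holds m′ v s
          holds′-other {v} v≢h H = trans (m′-other (toℕ v) (≢toℕ v≢h)) H

          cases : ∀ {v s} → Holds m′ v s → (v ≡ h × s ≡ u) ⊎ (v ≢ h × Holds m v s)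
          cases {v} H with v Fin.≟ h
          ... | yes refl = inj₁ (refl , Fin.toℕ-injective (suc-injective (trans (sym H) holds′-h)))
          ... | no v≢h   = inj₂ (v≢h , trans (sym (m′-other (toℕ v) (≢toℕ v≢h))) H)

          u-loaded : toℕ u < i
          u-loaded with cur-wf
          ... | inj₁ eq = contradiction (trans (sym cur≡u) eq) λ ()
          ... | inj₂ (w , eq , w<i) = subst (_< i) (suc-injective (trans (sym eq) cur≡u)) w<i

        -- The price rises from at most `n`, hence stays below the mark `2 + n`. Slack holds for `u`
        -- because its item was cheapest, and survives for the others because prices never fall. The
        -- outbid holder had only this item, so it may become the bidder.
        bid : Invariant p′ m′ (m (toℕ h)) i
        bid = record
          { i≤n = i≤n
          ; m-wf = m-wf′
          ; priced = priced′
          ; h-alive = λ H → case cases H of λ { (inj₁ (refl , _)) → h-alive′ ; (inj₂ (_ , H)) → alive-to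
              (h-alive H) }
          ; s-alive = λ H → case cases H of λ { (inj₁ (_ , refl)) → alive-to (cur-alive cur≡u) ;
              (inj₂ (_ , H)) → alive-to (s-alive H) }
          ; s-adj = λ H → case cases H of λ { (inj₁ (refl , refl)) → uh ; (inj₂ (_ , H)) → s-adj H }
          ; s-loaded = λ H → case cases H of λ { (inj₁ (_ , refl)) → u-loaded ; (inj₂ (_ , H)) → s-loaded H }
          ; s-passive = λ H old → case cases H of λ
              { (inj₁ (_ , refl)) → s-passive old cur≡u
              ; (inj₂ (v≢h , H)) → v≢h (injective H old) }
          ; injective = λ H H′ → injective′ (cases H) (cases H′)
          ; slack = λ H j sj → slack′ (cases H) j sj
          ; served = λ {s} as s<i → served′ (served (alive-from as) s<i)
          ; cur-alive = λ H → alive-to (s-alive H)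
          ; cur-wf = case m-wf h of λ { (inj₁ eq) → inj₁ eq ; (inj₂ (s , H)) → inj₂ (s , H , s-loaded H) }
          ; fresh = λ v i≤v → alive-to (fresh v i≤v)
          }
          where
          m-wf′ : ∀ v → m′ (toℕ v) ≡ 0 ⊎ ∃[ s ] Holds m′ v s
          m-wf′ v with v Fin.≟ h
          ... | yes refl = inj₂ (u , holds′-h)
          ... | no v≢h   = Sum.map (trans (m′-other (toℕ v) (≢toℕ v≢h)))
              (λ (s , H) → s , holds′-other v≢h H) (m-wf v)
          priced′ : ∀ {v} → Alive p′ v → 0 < p′ (toℕ v) → ∃[ s ] Holds m′ v s
          priced′ {v} a 0<p with v Fin.≟ h
          ... | yes refl = u , holds′-h
          ... | no v≢h with priced (alive-from a) (subst (0 <_) (p′-other (toℕ v) (≢toℕ v≢h)) 0<p)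
          ...   | s , H = s , holds′-other v≢h H
          injective′ : ∀ {v w s} → (v ≡ h × s ≡ u) ⊎ (v ≢ h × Holds m v s) → (w ≡ h × s ≡ u) ⊎
              (w ≢ h × Holds m w s) → v ≡ w
          injective′ (inj₁ (refl , _)) (inj₁ (refl , _)) = refl
          injective′ (inj₁ (_ , refl)) (inj₂ (_ , H))    = contradiction cur≡u (s-passive H)
          injective′ (inj₂ (_ , H))    (inj₁ (_ , refl)) = contradiction cur≡u (s-passive H)
          injective′ (inj₂ (_ , H))    (inj₂ (_ , H′))   = injective H H′
          slack′ : ∀ {v s} → (v ≡ h × s ≡ u) ⊎ (v ≢ h × Holds m v s) → ∀ j → adj G s j ≡ true → p′ (toℕ v) ≤
              suc (p′ (toℕ j))
          slack′ (inj₁ (refl , refl)) j uj = ≤-trans (≤-reflexive p′-h) (s≤s (≤-trans (minimal j uj) (p≤p′ j)))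
          slack′ {v} (inj₂ (v≢h , H)) j sj =
            ≤-trans (≤-reflexive (p′-other (toℕ v) (≢toℕ v≢h))) (≤-trans (slack H j sj) (s≤s (p≤p′ j)))
          served′ : ∀ {s} → cur ≡ suc (toℕ s) ⊎ ∃[ v ] Holds m v s → m (toℕ h) ≡ suc (toℕ s) ⊎ ∃[ v ] Holds
              m′ v s
          served′ (inj₁ eq) = inj₂ (h , trans m′-h eq)
          served′ (inj₂ (v , H)) with v Fin.≟ h
          ... | yes refl = inj₁ H
          ... | no v≢h   = inj₂ (v , holds′-other v≢h H)

        bid-potential : potential p′ < potential p
        bid-potential = sumTo-decreases n (Fin.toℕ<n h) (λ v v≢h → cong (2 + n ∸_) (p′-other v v≢h))
          (subst (λ x → 2 + n ∸ x < 2 + n ∸ p (toℕ h)) (sym p′-h) (∸-monoʳ-< ≤-refl (s≤s (m≤n⇒m≤1+n cheap))))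

        bid-reduction : Reduction p → Reduction p′
        bid-reduction R = record
          { deleted = deleted
          ; count = trans (cong (_+ deleted) (sumTo-cong n same)) count
          ; shrink = λ ℓ C → code-resp {P = Alive p} {P′ = Alive p′} alive-to alive-from (shrink ℓ C)
          ; grow = λ ℓ C → grow ℓ (code-resp {P = Alive p′} {P′ = Alive p} alive-from alive-to C)
          ; deleted≤ = deleted≤
          }
          where
          open Reduction R
          same : ∀ v → v < n → sgn (2 + n ∸ p′ v) ≡ sgn (2 + n ∸ p v)
          same v _ with v ≟ toℕ h
          ... | no v≢h   = cong (λ x → sgn (2 + n ∸ x)) (p′-other v v≢h)
          ... | yes refl = trans (sgn-pos (m<n⇒0<n∸m h-alive′))
              (sym (sgn-pos (m<n⇒0<n∸m (alive-from h-alive′))))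

      module Drop (expensive : ∀ j → adj G u j ≡ true → n < p (toℕ j))
                  (p′-u : p′ (toℕ u) ≡ 2 + n) (p′-other : ∀ v → v ≢ toℕ u → p′ v ≡ p v)
                  (m′-u : m′ (toℕ u) ≡ 0) (m′-other : ∀ v → v ≢ toℕ u → m′ v ≡ m v) where

        private
          u-alive : Alive p u
          u-alive = cur-alive cur≡u

          alive-to : ∀ {v} → v ≢ u → Alive p v → Alive p′ v
          alive-to {v} v≢u a = subst (_< 2 + n) (sym (p′-other (toℕ v) (≢toℕ v≢u))) a

          alive-from : ∀ {v} → Alive p′ v → Alive p v × v ≢ u
          alive-from {v} a with v Fin.≟ u
          ... | yes refl = contradiction p′-u (<⇒≢ a)
          ... | no v≢u   = subst (_< 2 + n) (p′-other (toℕ v) (≢toℕ v≢u)) a , v≢u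

          p≤p′ : ∀ v → p (toℕ v) ≤ p′ (toℕ {n} v)
          p≤p′ v with v Fin.≟ u
          ... | yes refl = subst (p (toℕ u) ≤_) (sym p′-u) (<⇒≤ u-alive)
          ... | no v≢u   = ≤-reflexive (sym (p′-other (toℕ v) (≢toℕ v≢u)))

          from : ∀ {v s} → Holds m′ v s → v ≢ u × Holds m v s
          from {v} H with v Fin.≟ u
          ... | yes refl = contradiction (trans (sym m′-u) H) λ ()
          ... | no v≢u   = v≢u , trans (sym (m′-other (toℕ v) (≢toℕ v≢u))) H

          to : ∀ {v s} → v ≢ u → Holds m v s → Holds m′ v s
          to {v} v≢u H = trans (m′-other (toℕ v) (≢toℕ v≢u)) H

          s≢u : ∀ {v s} → Holds m v s → s ≢ u
          s≢u H refl = s-passive H cur≡u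

        -- The vertex `u` disappears in both roles. As the current bidder it holds nothing, so the
        -- only one affected is the holder of item `u`, who bids next.
        drop : Invariant p′ m′ (m (toℕ u)) i
        drop = record
          { i≤n = i≤n
          ; m-wf = m-wf′
          ; priced = priced′
          ; h-alive = λ H → alive-to (proj₁ (from H)) (h-alive (proj₂ (from H)))
          ; s-alive = λ H → alive-to (s≢u (proj₂ (from H))) (s-alive (proj₂ (from H)))
          ; s-adj = λ H → s-adj (proj₂ (from H))
          ; s-loaded = λ H → s-loaded (proj₂ (from H))
          ; s-passive = λ H old → proj₁ (from H) (injective (proj₂ (from H)) old)
          ; injective = λ H H′ → injective (proj₂ (from H)) (proj₂ (from H′))
          ; slack = λ {v} H j sj → ≤-trans (≤-reflexive (p′-other (toℕ v) (≢toℕ (proj₁ (from H)))))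
                                     (≤-trans (slack (proj₂ (from H)) j sj) (s≤s (p≤p′ j)))
          ; served = λ as s<i → served′ (proj₂ (alive-from as)) (served (proj₁ (alive-from as)) s<i)
          ; cur-alive = λ H → alive-to (s≢u H) (s-alive H)
          ; cur-wf = case m-wf u of λ { (inj₁ eq) → inj₁ eq ; (inj₂ (s , H)) → inj₂ (s , H , s-loaded H) }
          ; fresh = λ v i≤v → alive-to (λ { refl → <⇒≱ u-loaded i≤v }) (fresh v i≤v)
          }
          where
          u-loaded : toℕ u < i
          u-loaded with cur-wf
          ... | inj₁ eq = contradiction (trans (sym cur≡u) eq) λ ()
          ... | inj₂ (w , eq , w<i) = subst (_< i) (suc-injective (trans (sym eq) cur≡u)) w<i
          m-wf′ : ∀ v → m′ (toℕ v) ≡ 0 ⊎ ∃[ s ] Holds m′ v s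
          m-wf′ v with v Fin.≟ u
          ... | yes refl = inj₁ m′-u
          ... | no v≢u   = Sum.map (trans (m′-other (toℕ v) (≢toℕ v≢u))) (λ (s , H) → s , to v≢u H) (m-wf v)
          priced′ : ∀ {v} → Alive p′ v → 0 < p′ (toℕ v) → ∃[ s ] Holds m′ v s
          priced′ {v} a 0<p with alive-from a
          ... | a′ , v≢u with priced a′ (subst (0 <_) (p′-other (toℕ v) (≢toℕ v≢u)) 0<p)
          ...   | s , H = s , to v≢u H
          served′ : ∀ {s} → s ≢ u → cur ≡ suc (toℕ s) ⊎ ∃[ v ] Holds m v s → m (toℕ u) ≡ suc (toℕ s) ⊎ ∃[ v
              ] Holds m′ v s
          served′ s≢u (inj₁ eq) = contradiction (Fin.toℕ-injective (suc-injective (trans (sym eq) cur≡u))) s≢u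
          served′ s≢u (inj₂ (v , H)) with v Fin.≟ u
          ... | yes refl = inj₁ H
          ... | no v≢u   = inj₂ (v , to v≢u H)

        drop-potential : potential p′ < potential p
        drop-potential = sumTo-decreases n (Fin.toℕ<n u) (λ v v≢u → cong (2 + n ∸_) (p′-other v v≢u))
          (subst (λ x → 2 + n ∸ x < 2 + n ∸ p (toℕ u)) (sym p′-u) (∸-monoʳ-< u-alive ≤-refl))

        -- No price equals some t ≤ n, and by the slack condition the bidders
        -- holding the items above t have all their neighbours above t.
        drop-code : ∀ {k} → Code G (Alive p) k → ∃[ k′ ] (q * k′ ≤ k × Code G (λ v → Alive p v × v ≢ u) k′)
        drop-code with price-gap p
        ... | t , t≤n , gap = surplus-vertex {P = Alive p} {R = λ h → Alive p h × t < p (toℕ h)} (Alive? p)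
            (λ h → Alive? p h ×-dec (t <? p (toℕ h))) f u u-alive
          (λ h R → trans (symm G h (f h)) (s-adj (f-holds R)) , s-alive (f-holds R) , s≢u (f-holds R))
          (λ h h′ R R′ eq → injective (f-holds R) (subst (Holds m h′) (sym eq) (f-holds R′)))
          (λ j a uj → a , ≤-<-trans t≤n (expensive j uj))
          (λ h R j a sj → a , ≤∧≢⇒< (≤-pred (≤-trans (proj₂ R) (slack (f-holds R) j sj))) (gap j ∘ sym))
          where
          holder : ∀ {h} → m (toℕ h) ≡ 0 ⊎ ∃[ s ] Holds m h s → Fin n
          -- A default for items without a holder; those above the gap all have one, by `priced`.
          holder (inj₁ _)       = u
          holder (inj₂ (s , _)) = s
          f : Fin n → Fin n
          f h = holder (m-wf h)
          f-holds : ∀ {h} → Alive p h × t < p (toℕ h) → Holds m h (f h)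
          f-holds {h} (a , t<p) with m-wf h
          ... | inj₂ (s , H) = H
          ... | inj₁ m≡0 with priced a (≤-<-trans z≤n t<p)
          ...   | s , H = contradiction (trans (sym m≡0) H) λ ()

        drop-reduction : Reduction p → Reduction p′
        drop-reduction R = record
          { deleted = suc deleted
          ; count = trans (+-suc _ deleted) (trans (cong (_+ deleted) (sym count-p)) count)
          ; shrink = λ ℓ C → case drop-code (shrink (suc ℓ)
              (subst (λ e → Code G (λ _ → ⊤) (q ^ e)) (sym (+-suc deleted ℓ)) C)) of λ
              { (k , qk≤ , C′) → code-mono (*-cancelˡ-≤ q qk≤)
                  (code-resp {P = λ v → Alive p v × v ≢ u} {P′ = Alive p′} (λ (a , v≢u) → alive-to v≢u a)
                  alive-from C′) }
          ; grow = λ ℓ C → subst (λ e → Code G (λ _ → ⊤) (q ^ e)) (+-suc deleted ℓ)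
              (grow (suc ℓ) (code-resp {P = λ v → Alive p′ v ⊎ v ≡ u} {P′ = Alive p} restore split
                  (add-vertex {P = Alive p′} u C)))
          -- Equality would leave a code with a single message for a set that still contains `u`.
          ; deleted≤ = λ ℓ C → ≤∧≢⇒< (deleted≤ ℓ C) λ { refl →
              trivial-code {P = Alive p} u u-alive
                  (shrink 0 (subst (λ e → Code G (λ _ → ⊤) (q ^ e)) (sym (+-identityʳ deleted)) C)) }
          }
          where
          open Reduction R
          count-p : alive-count p n ≡ suc (alive-count p′ n)
          count-p = trans (sym (+-identityʳ _)) (trans (cong (alive-count p n +_) (sym dead))
            (trans (sumTo-update n (Fin.toℕ<n u) λ v v≢u → cong (λ x → sgn (2 + n ∸ x)) (sym (p′-other v v≢u)))
              (trans (cong (alive-count p′ n +_) (sgn-pos (m<n⇒0<n∸m u-alive))) (+-comm _ 1))))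
            where
            dead : sgn (2 + n ∸ p′ (toℕ u)) ≡ 0
            dead = cong sgn (trans (cong (2 + n ∸_) p′-u) (n∸n≡0 (2 + n)))
          restore : ∀ {v} → Alive p′ v ⊎ v ≡ u → Alive p v
          restore (inj₁ a)    = proj₁ (alive-from a)
          restore (inj₂ refl) = u-alive
          split : ∀ {v} → Alive p v → Alive p′ v ⊎ v ≡ u
          split {v} a with v Fin.≟ u
          ... | yes eq = inj₂ eq
          ... | no v≢u = inj₁ (alive-to v≢u a)

    -- Listing the surviving vertices

    record Listing (L p : ℕ → ℕ) (c j : ℕ) : Set where
      field
        sound    : ∀ {a} → a < c → Σ[ v ∈ Fin n ] (L a ≡ toℕ v × toℕ v < j × Alive p v)
        complete : ∀ {v} → Alive p v → toℕ v < j → ∃[ a ] (a < c × L a ≡ toℕ v)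
        distinct : ∀ {a b} → a < c → b < c → L a ≡ L b → a ≡ b

    listing-[] : ∀ {L p} → Listing L p 0 0
    listing-[] = record { sound = λ () ; complete = λ _ () ; distinct = λ () }

    listing-snoc : ∀ {L L′ p c} {v : Fin n} → Alive p v → L′ c ≡ toℕ v → (∀ a → a ≢ c → L′ a ≡ L a) →
                   Listing L p c (toℕ v) → Listing L′ p (suc c) (suc (toℕ v))
    listing-snoc {L} {L′} {p} {c} {v} alive L′c L′-other listing = record
        { sound = sound′ ; complete = complete′ ; distinct = distinct′ }
      where
      open Listing listing
      old : ∀ {a} → a < c → L′ a ≡ L a
      old a<c = L′-other _ (<⇒≢ a<c)
      split : ∀ {a} → a < suc c → a < c ⊎ a ≡ c
      split a≤c = m≤n⇒m<n∨m≡n (≤-pred a≤c)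
      sound′ : ∀ {a} → a < suc c → Σ[ w ∈ Fin n ] (L′ a ≡ toℕ w × toℕ w < suc (toℕ v) × Alive p w)
      sound′ a≤c with split a≤c
      ... | inj₂ refl = v , L′c , ≤-refl , alive
      ... | inj₁ a<c with sound a<c
      ...   | w , eq , w<v , alive-w = w , trans (old a<c) eq , m<n⇒m<1+n w<v , alive-w
      complete′ : ∀ {w} → Alive p w → toℕ w < suc (toℕ v) → ∃[ a ] (a < suc c × L′ a ≡ toℕ w)
      complete′ alive-w w≤v with m≤n⇒m<n∨m≡n (≤-pred w≤v)
      ... | inj₂ eq = c , ≤-refl , trans L′c (sym eq)
      ... | inj₁ w<v with complete alive-w w<v
      ...   | a , a<c , eq = a , m<n⇒m<1+n a<c , trans (old a<c) eq
      new : ∀ {a} → a < c → L′ a ≢ L′ c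
      new a<c eq with sound a<c
      ... | w , eq′ , w<v , _ = <⇒≢ w<v (trans (sym eq′) (trans (sym (old a<c)) (trans eq L′c)))
      distinct′ : ∀ {a b} → a < suc c → b < suc c → L′ a ≡ L′ b → a ≡ b
      distinct′ a≤c b≤c eq with split a≤c | split b≤c
      ... | inj₁ a<c  | inj₁ b<c  = distinct a<c b<c (trans (sym (old a<c)) (trans eq (old b<c)))
      ... | inj₁ a<c  | inj₂ refl = contradiction eq (new a<c)
      ... | inj₂ refl | inj₁ b<c  = contradiction (sym eq) (new b<c)
      ... | inj₂ refl | inj₂ refl = refl

    listing-skip : ∀ {L p c} {v : Fin n} → ¬ Alive p v → Listing L p c (toℕ v) → Listing L p c (suc (toℕ v))
    listing-skip {L} {p} {c} {v} dead listing = record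
      { sound = λ a<c → case sound a<c of λ (w , eq , w<v , alive) → w , eq , m<n⇒m<1+n w<v , alive
      ; complete = complete′
      ; distinct = distinct }
      where
      open Listing listing
      complete′ : ∀ {w} → Alive p w → toℕ w < suc (toℕ v) → ∃[ a ] (a < c × L a ≡ toℕ w)
      complete′ alive w≤v with m≤n⇒m<n∨m≡n (≤-pred w≤v)
      ... | inj₁ w<v = complete alive w<v
      ... | inj₂ eq  = contradiction (subst (Alive p) (Fin.toℕ-injective eq) alive) dead

    -- The induced graph on the survivors

    module Kernel {p m L c} (I : Invariant p m 0 n) (R : Reduction p)
                  (listing : Listing L p c n) (c≡ : c ≡ alive-count p n) where

      open Invariant I
      open Reduction R
      open Listing listing

      ι : Fin c → Fin n
      ι a = proj₁ (sound (Fin.toℕ<n a))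

      L-ι : ∀ a → L (toℕ a) ≡ toℕ (ι a)
      L-ι a = proj₁ (proj₂ (sound (Fin.toℕ<n a)))

      kernel-graph : Graph c
      kernel-graph = record
        { adj = λ a b → adj G (ι a) (ι b)
        ; irrefl = λ a → irrefl G (ι a)
        ; symm = λ a b → symm G (ι a) (ι b)
        }

      private
        ι-injective : ∀ {a b} → ι a ≡ ι b → a ≡ b
        ι-injective {a} {b} eq = Fin.toℕ-injective (distinct (Fin.toℕ<n a) (Fin.toℕ<n b)
          (trans (L-ι a) (trans (cong toℕ eq) (sym (L-ι b)))))

        ι-alive : ∀ a → Alive p (ι a)
        ι-alive a = proj₂ (proj₂ (proj₂ (sound (Fin.toℕ<n a))))

        ι-onto : ∀ {v} → Alive p v → ∃[ a ] ι a ≡ v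
        ι-onto {v} alive with complete alive (Fin.toℕ<n v)
        ... | a , a<c , eq = fromℕ< a<c , Fin.toℕ-injective
          (trans (sym (L-ι (fromℕ< a<c))) (trans (cong L (Fin.toℕ-fromℕ< a<c)) eq))

      codes-shrink : ∀ ℓ → HasIndexCode A G (deleted + ℓ) → HasIndexCode A kernel-graph ℓ
      codes-shrink ℓ C = code-⊤⇒HasIndexCode
        (code-to-induced {G′ = kernel-graph} {G} ι ι-injective (λ _ _ → refl) ι-alive ι-onto
            (shrink ℓ (HasIndexCode⇒code-⊤ C)))

      codes-grow : ∀ ℓ → HasIndexCode A kernel-graph ℓ → HasIndexCode A G (deleted + ℓ)
      codes-grow ℓ C = code-⊤⇒HasIndexCode
        (grow ℓ (code-from-induced {G′ = kernel-graph} {G} ι ι-injective (λ _ _ → refl) ι-alive ι-onto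
            (HasIndexCode⇒code-⊤ C)))

      private
        n≡ : deleted + c ≡ n
        n≡ = trans (+-comm deleted c) (trans (cong (_+ deleted) c≡) count)

        shift : ∀ {ℓ k} → ℓ + k ≤ c → deleted + ℓ + k ≤ n
        shift {ℓ} {k} le = ≤-trans (≤-reflexive (+-assoc deleted ℓ k))
            (≤-trans (+-monoʳ-≤ deleted le) (≤-reflexive n≡))

        unshift : ∀ {ℓ k} → deleted + ℓ + k ≤ n → ℓ + k ≤ c
        unshift {ℓ} {k} le = +-cancelˡ-≤ deleted _ _
            (≤-trans (≤-reflexive (sym (+-assoc deleted ℓ k))) (≤-trans le (≤-reflexive (sym n≡))))

      -- The order and the least code length both fall by `deleted`, so their difference is
      -- unchanged and so is `k`.
      kernel-equivalent : ∀ k → DualIndexCoding q (instance-of G k) ⇔ DualIndexCoding q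
          (instance-of kernel-graph k)
      kernel-equivalent k = mk⇔ to from
        where
        to : DualIndexCoding q (instance-of G k) → DualIndexCoding q (instance-of kernel-graph k)
        to (ℓ , (C , low) , le) with m≤n⇒∃[o]m+o≡n (deleted≤ ℓ (HasIndexCode⇒code-⊤ C))
        ... | ℓ′ , refl = ℓ′ , (codes-shrink ℓ′ C , λ ℓ″ C″ → +-cancelˡ-≤ deleted _ _
            (low _ (codes-grow ℓ″ C″))) ,
          ≤-difference {k = k} (unshift (difference-≤ {k = k} le))
        from : DualIndexCoding q (instance-of kernel-graph k) → DualIndexCoding q (instance-of G k)
        from (ℓ′ , (C , low) , le) = deleted + ℓ′ , (codes-grow ℓ′ C , low′) , ≤-difference {k = k}
            (shift (difference-≤ {k = k} le))
          where
          low′ : ∀ ℓ → HasIndexCode A G ℓ → deleted + ℓ′ ≤ ℓ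
          low′ ℓ C′ with m≤n⇒∃[o]m+o≡n (deleted≤ ℓ (HasIndexCode⇒code-⊤ C′))
          ... | ℓ″ , refl = +-monoʳ-≤ deleted (low ℓ″ (codes-shrink ℓ″ C′))

      -- With no bidder left, `served` gives every survivor an item among the survivors; `τ` sends
      -- it there, and is injective because an item has a single holder.
      large-kernel : ∀ k → 3 * k ∸ 3 < c → DualIndexCoding q (instance-of G k)
      large-kernel k large with third-saving {G = kernel-graph} τ τ-injective τ-adj
        where
        item : ∀ a → ∃[ h ] Holds m h (ι a)
        item a with served (ι-alive a) (Fin.toℕ<n (ι a))
        ... | inj₂ H = H
        ... | inj₁ ()
        τ : Fin c → Fin c
        τ a = proj₁ (ι-onto (h-alive (proj₂ (item a))))
        τ-item : ∀ a → Holds m (ι (τ a)) (ι a)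
        τ-item a = subst (λ h → Holds m h (ι a)) (sym (proj₂ (ι-onto (h-alive (proj₂ (item a))))))
            (proj₂ (item a))
        τ-injective : ∀ {a b} → τ a ≡ τ b → a ≡ b
        τ-injective {a} {b} eq = ι-injective (Fin.toℕ-injective (suc-injective
          (trans (sym (τ-item a)) (trans (cong (λ x → m (toℕ (ι x))) eq) (τ-item b)))))
        τ-adj : ∀ a → adj kernel-graph a (τ a) ≡ true
        τ-adj a = s-adj (τ-item a)
      ... | s , ℓ , c≤3s , ℓ+s≡c , C with IsInd-exists {G = G} (deleted + ℓ)
          (codes-grow ℓ (code-⊤⇒HasIndexCode C))
      ...   | ℓ′ , ℓ′≤ , ind = ℓ′ , ind , ≤-difference (≤-trans (+-monoˡ-≤ k ℓ′≤) (shift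
        (≤-trans (+-monoʳ-≤ ℓ (k≤s k large)) (≤-reflexive ℓ+s≡c))))
        where
        -- For `suc k` the threshold is `3 * k`, and `3 * k < c ≤ 3 * s` gives `k < s`.
        k≤s : ∀ k → 3 * k ∸ 3 < c → k ≤ s
        k≤s zero    _     = z≤n
        k≤s (suc k) large = *-cancelˡ-< 3 k s (≤-trans
            (s≤s (≤-reflexive (sym (trans (cong (_∸ 3) (*-suc 3 k)) (m+n∸m≡n 3 (3 * k))))))
            (≤-trans large c≤3s))

    -- Correctness of the program

    module _ (k : ℕ) where

      Header State Main : Store → Set
      Header σ = σ 0 0 0 ≡ n × σ 1 0 0 ≡ k × (∀ i j → σ 2 (toℕ i) (toℕ j) ≡ bit (adj G i j))
      State σ  = Invariant (λ v → σ 3 v 0) (λ v → σ 4 v 0) (σ 8 0 0) (σ 7 0 0) × Reduction (λ v → σ 3 v 0)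
      Main σ   = Header σ × State σ

      -- A bid uses one unit of the potential, a deletion all that remains at `u`, and a load one
      -- unit of the second summand.
      measure : Store → ℕ
      measure σ = potential (λ v → σ 3 v 0) + (n ∸ σ 7 0 0)

      -- The scan starts from the sentinel `suc n` and compares strictly, so it accepts only prices
      -- up to `n`. The same test passes over deleted neighbours, whose price is `2 + n`; finding
      -- nothing thus means that all neighbours cost more than `n`.
      Scanned : Fin n → ℕ → ℕ → Store → Set
      Scanned u M j σ = Main σ × measure σ ≡ M × σ 8 0 0 ≡ suc (toℕ u) × σ 10 0 0 ≤ suc n ×
        (∀ v → toℕ v < j → adj G u v ≡ true → σ 10 0 0 ≤ σ 3 (toℕ v) 0) ×
        (σ 11 0 0 ≡ 0 × σ 10 0 0 ≡ suc n ⊎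
         Σ[ h ∈ Fin n ] (σ 11 0 0 ≡ suc (toℕ h) × adj G u h ≡ true × σ 10 0 0 ≡ σ 3 (toℕ h) 0 × σ 10 0 0 ≤ n))

      run-scan : ∀ {u M σ} → Scanned u M 0 σ → Run (for 9 (var 0) scan-step) σ (scanTime n) (Scanned u M n)
      run-scan {u} {M} = run-for n 100 (Scanned u M) (λ (((0≡n , _) , _) , _) → 0≡n) body
        where
        body : ∀ {j σ} → j < n → σ 9 0 0 ≡ j → Scanned u M j σ →
               Run scan-step σ 100 (λ τ → τ 9 0 0 ≡ j × Scanned u M (suc j) (update τ 9 0 0 (suc j)))
        body {σ = σ} j<n refl (main@((_ , _ , matrix≡) , _) , μ≡ , cur≡u , best≤ , minimal , found) =
          run-weaken (≤ᵇ⇒≤ _ 100 tt) (run-if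
            (λ edge → run-if
              (λ cheaper → run-write-then (run-write
                  (refl , main , μ≡ , cur≡u , <⇒≤ (<-≤-trans (lt cheaper) best≤) ,
                extend (λ v v<j uv → ≤-trans (<⇒≤ (lt cheaper)) (minimal v v<j uv)) (λ _ → ≤-refl) ,
                inj₂ (w , trans (+-comm _ 1) (cong suc (sym w≡j)) , bit-pos (subst (0 <_) entry edge) ,
                      cong (λ x → σ 3 x 0) (sym w≡j) , ≤-pred (<-≤-trans (lt cheaper) best≤)))))
              (λ dear → run-skip (refl , main , μ≡ , cur≡u , best≤ , extend minimal (λ _ → m∸n≡0⇒m≤n dear) ,
                  found)))
            (λ nonedge → run-skip (refl , main , μ≡ , cur≡u , best≤ ,
              extend minimal (λ uw → contradiction (trans (sym nonedge) (trans entry (cong bit uw))) λ ()) ,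
                  found)))
          where
          w : Fin n
          w = fromℕ< j<n
          w≡j : toℕ w ≡ σ 9 0 0
          w≡j = Fin.toℕ-fromℕ< j<n
          entry : σ 2 (σ 8 0 0 ∸ 1) (σ 9 0 0) ≡ bit (adj G u w)
          entry = trans (cong₂ (σ 2) (cong (_∸ 1) cur≡u) (sym w≡j)) (matrix≡ u w)
          lt : 0 < σ 10 0 0 ∸ σ 3 (σ 9 0 0) 0 → σ 3 (σ 9 0 0) 0 < σ 10 0 0
          lt pos = m∸n≢0⇒n<m (<⇒≢ pos ∘ sym)
          extend : ∀ {b} → (∀ v → toℕ v < σ 9 0 0 → adj G u v ≡ true → b ≤ σ 3 (toℕ v) 0) →
                   (adj G u w ≡ true → b ≤ σ 3 (σ 9 0 0) 0) →
                   ∀ v → toℕ v < suc (σ 9 0 0) → adj G u v ≡ true → b ≤ σ 3 (toℕ v) 0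
          extend {b} below at v v≤j uv with m≤n⇒m<n∨m≡n (≤-pred v≤j)
          ... | inj₁ v<j = below v v<j uv
          ... | inj₂ v≡j = subst (λ x → b ≤ σ 3 x 0) (sym v≡j)
            (at (subst (λ x → adj G u x ≡ true) (Fin.toℕ-injective (trans v≡j (sym w≡j))) uv))

      run-bid : ∀ {u M σ} → Scanned u M n σ → 0 < σ 11 0 0 → Run bid-step σ 50 (λ τ → Main τ × measure τ < M)
      run-bid (_ , _ , _ , _ , _ , inj₁ (none , _)) pos = contradiction (sym none) (<⇒≢ pos)
      run-bid {u} {_} {σ} ((header , I , R) , refl , cur≡u , best≤ , minimal , inj₂
          (h , item≡h , uh , best≡ , best≤n)) _ =
        run-weaken (≤ᵇ⇒≤ _ 50 tt) (run-write-then (run-write-then (run-write-then (run-write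
          ( (header , subst (λ x → Invariant _ _ (σ 4 x 0) (σ 7 0 0)) (sym a≡h) B.bid , B.bid-reduction R)
          , +-monoˡ-< (n ∸ σ 7 0 0) B.bid-potential)))))
        where
        a≡h : σ 11 0 0 ∸ 1 ≡ toℕ h
        a≡h = cong (_∸ 1) item≡h
        module B = Bid I cur≡u {h} uh (subst (_≤ n) best≡ best≤n)
          (λ j uj → subst (_≤ σ 3 (toℕ j) 0) best≡ (minimal j (Fin.toℕ<n j) uj))
          (trans (update-at σ 3 {j = 0} (σ 10 0 0 + 1) a≡h refl) (trans (+-comm _ 1) (cong suc best≡)))
          (λ v v≢h → update-row σ 3 {j = 0} {l = 0} (σ 10 0 0 + 1) (λ eq → v≢h (trans (sym eq) a≡h)))
          (update-at σ 4 {j = 0} (σ 8 0 0) a≡h refl)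
          (λ v v≢h → update-row σ 4 {j = 0} {l = 0} (σ 8 0 0) (λ eq → v≢h (trans (sym eq) a≡h)))

      run-drop : ∀ {u M σ} → Scanned u M n σ → σ 11 0 0 ≡ 0 → Run drop-step σ 50 (λ τ → Main τ × measure τ < M)
      run-drop (_ , _ , _ , _ , _ , inj₂ (h , item≡h , _)) none = contradiction (trans (sym none) item≡h) λ ()
      run-drop {u} {_} {σ} ((header@(0≡n , _) , I , R) , refl , cur≡u , _ , minimal , inj₁ (_ , best≡)) _ =
        run-weaken (≤ᵇ⇒≤ _ 50 tt) (run-write-then (run-write-then (run-write-then (run-write
          ( (header , subst (λ x → Invariant _ _ (σ 4 x 0) (σ 7 0 0)) (sym a≡u) D.drop , D.drop-reduction R)
          , +-monoˡ-< (n ∸ σ 7 0 0) D.drop-potential)))))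
        where
        a≡u : σ 8 0 0 ∸ 1 ≡ toℕ u
        a≡u = cong (_∸ 1) cur≡u
        module D = Drop I cur≡u
          (λ j uj → subst (_≤ σ 3 (toℕ j) 0) best≡ (minimal j (Fin.toℕ<n j) uj))
          (trans (update-at σ 3 {j = 0} (σ 0 0 0 + 2) a≡u refl) (trans (+-comm _ 2) (cong (2 +_) 0≡n)))
          (λ v v≢u → update-row σ 3 {j = 0} {l = 0} (σ 0 0 0 + 2) (λ eq → v≢u (trans (sym eq) a≡u)))
          (update-at σ 4 {j = 0} 0 a≡u refl)
          (λ v v≢u → update-row σ 4 {j = 0} {l = 0} 0 (λ eq → v≢u (trans (sym eq) a≡u)))

      run-auction-step : ∀ {σ} → Main σ → 0 < σ 8 0 0 → Run auction-step σ (150 + scanTime n)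
          (λ τ → Main τ × measure τ < measure σ)
      run-auction-step {σ} main@((0≡n , _) , I , _) pos with Invariant.cur-wf I
      ... | inj₁ cur≡0 = contradiction (sym cur≡0) (<⇒≢ pos)
      ... | inj₂ (u , cur≡u , _) = run-weaken time≤ (run-write-then (run-write-then
        (run-scan (main , refl , cur≡u , ≤-reflexive best≡ , (λ _ ()) , inj₁ (refl , best≡)) then λ scanned →
          run-if (run-bid scanned) (run-drop scanned))))
        where
        best≡ : σ 0 0 0 + 1 ≡ suc n
        best≡ = trans (+-comm _ 1) (cong suc 0≡n)
        time≤ : 12 + (scanTime n + 104) ≤ 150 + scanTime n
        time≤ = ≤-trans (≤-reflexive (cong (12 +_) (+-comm (scanTime n) 104)))
            (+-monoˡ-≤ (scanTime n) (≤ᵇ⇒≤ 116 150 tt))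

      run-load-step : ∀ {σ} → Main σ → 0 < ⟦ auction-guard ⟧ σ → σ 8 0 0 ≡ 0 → Run load-step σ 50
          (λ τ → Main τ × measure τ < measure σ)
      run-load-step {σ} ((header@(0≡n , _) , I , R)) guard cur≡0 = run-weaken (≤ᵇ⇒≤ _ 50 tt)
          (run-write-then (run-write
        ( (header , subst (λ x → Invariant (λ v → σ 3 v 0) (λ v → σ 4 v 0) x x) (+-comm 1 (σ 7 0 0))
              (load i<n (subst (λ x → Invariant (λ v → σ 3 v 0) (λ v → σ 4 v 0) x (σ 7 0 0)) cur≡0 I)) , R)
        , +-monoʳ-< (potential (λ v → σ 3 v 0))
            (subst (λ x → n ∸ x < n ∸ σ 7 0 0) (+-comm 1 (σ 7 0 0)) (∸-monoʳ-< ≤-refl i<n)))))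
        where
        i<n : σ 7 0 0 < n
        i<n = m∸n≢0⇒n<m λ eq → <⇒≢ guard (sym (trans (cong₂ _+_ (cong (_∸ σ 7 0 0) 0≡n) cur≡0)
            (trans (+-identityʳ _) eq)))

      run-auction : ∀ {σ} → Main σ → measure σ ≤ n * (2 + n) + n →
                    Run auction σ (auctionTime n) (λ τ → Main τ × ⟦ auction-guard ⟧ τ ≡ 0)
      run-auction = run-while (300 + scanTime n) Main measure
        (λ main guard → run-weaken time≤ (run-if (run-auction-step main) (run-load-step main guard)))
            (n * (2 + n) + n)
        where
        time≤ : 4 + (150 + scanTime n + 50) ≤ 300 + scanTime n
        time≤ = ≤-trans (≤-reflexive (cong (154 +_) (+-comm (scanTime n) 50)))
            (+-monoˡ-≤ (scanTime n) (≤ᵇ⇒≤ 204 300 tt))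

      Listed : Store → ℕ → Store → Set
      Listed σ₀ j σ = Header σ × (∀ v → σ 3 v ≡ σ₀ 3 v) × σ 13 0 0 ≡ alive-count (λ v → σ₀ 3 v 0) j ×
        Listing (λ a → σ 5 a 0) (λ v → σ₀ 3 v 0) (σ 13 0 0) j

      run-listing : ∀ {σ₀ σ} → Listed σ₀ 0 σ → Run (for 9 (var 0) listing-step) σ (listingTime n) (Listed σ₀ n)
      run-listing {σ₀} = run-for n 100 (Listed σ₀) (λ ((0≡n , _) , _) → 0≡n) body
        where
        body : ∀ {j σ} → j < n → σ 9 0 0 ≡ j → Listed σ₀ j σ →
               Run listing-step σ 100 (λ τ → τ 9 0 0 ≡ j × Listed σ₀ (suc j) (update τ 9 0 0 (suc j)))
        body {j} {σ} j<n refl (header@(0≡n , _) , prices , count , listing) = run-weaken (≤ᵇ⇒≤ _ 100 tt) (run-if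
          (λ alive → run-write-then (run-write (refl , header , prices ,
            trans (cong₂ _+_ count (sym (trans (cong sgn (sym test)) (sgn-pos alive)))) refl ,
            subst₂ (Listing _ _) (+-comm 1 (σ 13 0 0)) (cong suc w≡j)
              (listing-snoc {v = w} (alive⇒ alive) (trans (update-at σ 5 {j = 0} (σ 9 0 0) refl refl) (sym w≡j))
                (λ a a≢c → update-row σ 5 {j = 0} {l = 0} (σ 9 0 0) (a≢c ∘ sym))
                    (subst (Listing _ _ _) (sym w≡j) listing)))))
          (λ dead → run-skip (refl , header , prices ,
            trans count (trans (sym (+-identityʳ _))
                (cong (alive-count (λ v → σ₀ 3 v 0) (σ 9 0 0) +_) (cong sgn (trans (sym dead) test)))) ,
            subst (Listing _ _ _) (cong suc w≡j)
                (listing-skip {v = w} (dead⇒ dead) (subst (Listing _ _ _) (sym w≡j) listing)))))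
          where
          w : Fin n
          w = fromℕ< j<n
          w≡j : toℕ w ≡ σ 9 0 0
          w≡j = Fin.toℕ-fromℕ< j<n
          test : σ 0 0 0 + 2 ∸ σ 3 (σ 9 0 0) 0 ≡ 2 + n ∸ σ₀ 3 (σ 9 0 0) 0
          test = cong₂ _∸_ (trans (+-comm _ 2) (cong (2 +_) 0≡n)) (cong (λ f → f 0) (prices (σ 9 0 0)))
          alive⇒ : 0 < σ 0 0 0 + 2 ∸ σ 3 (σ 9 0 0) 0 → Alive (λ v → σ₀ 3 v 0) w
          alive⇒ alive = m∸n≢0⇒n<m λ eq → <⇒≢ alive
              (sym (trans test (trans (cong (λ x → 2 + n ∸ σ₀ 3 x 0) (sym w≡j)) eq)))
          dead⇒ : σ 0 0 0 + 2 ∸ σ 3 (σ 9 0 0) 0 ≡ 0 → ¬ Alive (λ v → σ₀ 3 v 0) w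
          dead⇒ dead alive = <⇒≱ alive (subst (λ x → 2 + n ≤ σ₀ 3 x 0) (sym w≡j)
              (m∸n≡0⇒m≤n (trans (sym test) dead)))

      Solution : Store → Set
      Solution σ = Σ[ J ∈ Instance ] (Outputs σ J ×
        (DualIndexCoding q (instance-of G k) ⇔ DualIndexCoding q J) ×
        order J ≤ 3 * param J ∸ 3 × param J ≤ k)

      run-output : ∀ {σ₀ σ} → Main σ₀ → ⟦ auction-guard ⟧ σ₀ ≡ 0 → Listed σ₀ n σ →
        Run (fill 6 induced-entry ⨾ fill 2 scratch-entry ⨾ ifnz too-large (0 ≔ lit 0 ⨾ 1 ≔ lit 0)
            (0 ≔ var 13)) σ
            (fillTime induced-entry n + (fillTime scratch-entry n + 100)) Solution
      run-output {σ₀} {σ} ((0≡n₀ , _) , I , R) done ((0≡n , 1≡k , matrix≡) , _ , count≡ , listing) =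
        run-fill 6 induced-entry n induced Frame₁ (λ ()) (λ ()) proj₁
          (λ (_ , _ , _ , L≡ , A≡) _ _ → trans (A≡ _ _) (cong₂ (σ 2) (L≡ _) (L≡ _)))
          id id id {σ} (0≡n , 1≡k , refl , (λ _ → refl) , λ _ _ → refl) then λ
              ((0≡n , 1≡k , 13≡c , _) , scratch≡) →
        run-fill 2 scratch-entry n induced Frame₂ (λ ()) (λ ()) proj₁
          (λ (_ , _ , _ , scratch≡) i<n j<n → scratch≡ i<n j<n)
          id id id (0≡n , 1≡k , 13≡c , scratch≡) then λ {τ} ((0≡n , 1≡k , 13≡c , _) , output≡) →
        run-weaken (≤ᵇ⇒≤ _ 100 tt) (run-if
          (λ large → run-write-then (run-write
            ( instance-of empty-graph 0 , (refl , refl , λ ())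
            , mk⇔ (λ _ → empty-yes) (λ _ → K.large-kernel k (large⇒ {τ} 13≡c 1≡k large))
            , z≤n , z≤n )))
          (λ small → run-write
            ( instance-of K.kernel-graph k
            , (13≡c , 1≡k , λ a b → trans (output≡ (a<n a) (a<n b))
                (trans (cong₂ (σ 2) (K.L-ι a) (K.L-ι b)) (matrix≡ (K.ι a) (K.ι b))))
            , K.kernel-equivalent k
            , small⇒ {τ} 13≡c 1≡k small , ≤-refl )))
        where
        c : ℕ
        c = σ 13 0 0
        cur≡0 : σ₀ 8 0 0 ≡ 0
        cur≡0 = m+n≡0⇒n≡0 (σ₀ 0 0 0 ∸ σ₀ 7 0 0) done
        i≡n : σ₀ 7 0 0 ≡ n
        i≡n = ≤-antisym (Invariant.i≤n I) (subst (_≤ σ₀ 7 0 0) 0≡n₀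
            (m∸n≡0⇒m≤n (m+n≡0⇒m≡0 (σ₀ 0 0 0 ∸ σ₀ 7 0 0) done)))
        module K = Kernel (subst₂ (Invariant (λ v → σ₀ 3 v 0) (λ v → σ₀ 4 v 0)) cur≡0 i≡n I) R listing count≡
        induced : ℕ → ℕ → ℕ
        induced a b = σ 2 (σ 5 a 0) (σ 5 b 0)
        -- The first pass must preserve its sources, arrays 2 and 5; the second overwrites array 2
        -- and draws on array 6.
        Frame₁ Frame₂ : Store → Set
        Frame₁ τ = τ 0 0 0 ≡ n × τ 1 0 0 ≡ k × τ 13 0 0 ≡ c × (∀ a → τ 5 a 0 ≡ σ 5 a 0) ×
            (∀ i j → τ 2 i j ≡ σ 2 i j)
        Frame₂ τ = τ 0 0 0 ≡ n × τ 1 0 0 ≡ k × τ 13 0 0 ≡ c × (∀ {i j} → i < n → j < n → τ 6 i j ≡ induced i j)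
        a<n : ∀ (a : Fin c) → toℕ a < n
        a<n a = <-≤-trans (Fin.toℕ<n a) (≤-trans (≤-reflexive count≡)
          (m+n≤o⇒m≤o _ (≤-reflexive (Reduction.count R))))
        excess : ∀ {τ} → τ 13 0 0 ≡ c → τ 1 0 0 ≡ k → ⟦ too-large ⟧ τ ≡ c ∸ (3 * k ∸ 3)
        excess 13≡c 1≡k = cong₂ _∸_ 13≡c (cong (_∸ 3) (trans (cong (λ k → k + k + k) 1≡k) (triple k)))
          where
          triple : ∀ k → k + k + k ≡ 3 * k
          triple = solve-∀
        large⇒ : ∀ {τ} → τ 13 0 0 ≡ c → τ 1 0 0 ≡ k → 0 < ⟦ too-large ⟧ τ → 3 * k ∸ 3 < c
        large⇒ {τ} 13≡c 1≡k large = m∸n≢0⇒n<m λ eq → <⇒≢ large (sym (trans (excess {τ} 13≡c 1≡k) eq))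
        small⇒ : ∀ {τ} → τ 13 0 0 ≡ c → τ 1 0 0 ≡ k → ⟦ too-large ⟧ τ ≡ 0 → c ≤ 3 * k ∸ 3
        small⇒ {τ} 13≡c 1≡k small = m∸n≡0⇒m≤n (trans (sym (excess {τ} 13≡c 1≡k)) small)

      run-kernelize : Run kernelize (input (instance-of G k)) (kernelizeTime n) Solution
      run-kernelize = run-auction main₀ potential≤ then λ {τ} ((header , state) , done) →
        run-write-then (run-listing {σ₀ = τ} (header , (λ _ → refl) , refl , listing-[]) then λ listed →
          run-output {σ₀ = τ} (header , state) done listed)
        where
        σ₀ : Store
        σ₀ = input (instance-of G k)
        main₀ : Main σ₀
        main₀ = (refl , refl , matrix-toℕ G) , initial (λ _ → refl) (λ _ → refl) , initial-reduction
            (λ _ → refl)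
        potential≤ : measure σ₀ ≤ n * (2 + n) + n
        potential≤ = +-monoˡ-≤ n (≤-reflexive (constant n))
          where
          constant : ∀ j → sumTo (λ _ → 2 + n) j ≡ j * (2 + n)
          constant zero    = refl
          constant (suc j) = trans (cong (_+ (2 + n)) (constant j)) (+-comm (j * (2 + n)) (2 + n))

  -- Assembling the kernelization

  module _ (I : Instance) where

    open Auction (graph I)

    abstract
      solve : Run kernelize (input I) (kernelizeTime (order I)) (Solution (param I))
      solve = run-kernelize (param I)

    n≤instanceSize : order I ≤ instanceSize I
    n≤instanceSize = ≤-trans (n≤n*n (order I)) (m≤m+n (graphSize (graph I)) _)
      where
      n≤n*n : ∀ n → n ≤ n * n
      n≤n*n zero    = z≤n
      n≤n*n (suc n) = m≤m+n (suc n) (n * suc n)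

  abstract
    kernelizeTime-bound : ∃[ a ] ∃[ d ] (∀ n → kernelizeTime n ≤ a * n ^ d + a)
    kernelizeTime-bound = polynomial-bound kernelizeTime-polynomial

  kernelization : Σ[ K ∈ Kernelization (DualIndexCoding q) ]
    (∀ I → order (kernel K I) ≤ 3 * param (kernel K I) ∸ 3 × param (kernel K I) ≤ param I)
  kernelization = record
    { program    = kernelize
    ; time       = λ I → Run.steps (solve I)
    ; kernel     = λ I → proj₁ (Run.post (solve I))
    ; computes   = λ I → Run.final (solve I) , Run.exec (solve I) , proj₁ (proj₂ (Run.post (solve I)))
    ; polynomial = steps-polynomial kernelizeTime-bound
    ; equivalent = λ I → proj₁ (proj₂ (proj₂ (Run.post (solve I))))
    ; bound      = sizeBound
    ; computable = sizeBound-computable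
    ; size-≤     = λ I → square≤ (proj₁ (small I)) (proj₂ (small I))
    ; param-≤    = λ I → ≤-trans (proj₂ (small I)) (k≤sizeBound (param I))
    } , small
    where
    small : ∀ I → order (proj₁ (Run.post (solve I))) ≤ 3 * param (proj₁ (Run.post (solve I))) ∸ 3 ×
                  param (proj₁ (Run.post (solve I))) ≤ param I
    small I = proj₂ (proj₂ (proj₂ (Run.post (solve I))))
    steps-polynomial : ∃[ a ] ∃[ d ] (∀ n → kernelizeTime n ≤ a * n ^ d + a) → PolynomialTime
        (λ I → Run.steps (solve I))
    steps-polynomial (a , d , le) = a , d , λ I → ≤-trans (Run.steps≤ (solve I)) (≤-trans (le (order I))
      (+-monoˡ-≤ a (*-monoʳ-≤ a (^-monoˡ-≤ d (n≤instanceSize I)))))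
    square≤ : ∀ {n k k′} → n ≤ 3 * k′ ∸ 3 → k′ ≤ k → n * n ≤ sizeBound k
    square≤ {n} {k} {k′} n≤ k′≤k = ≤-trans (*-mono-≤ n≤3k n≤3k)
      (≤-trans (≤-reflexive (nine k)) (*-monoʳ-≤ k (m≤m+n (9 * k) 1)))
      where
      n≤3k : n ≤ 3 * k
      n≤3k = ≤-trans n≤ (≤-trans (m∸n≤m (3 * k′) 3) (*-monoʳ-≤ 3 k′≤k))
      nine : ∀ k → 3 * k * (3 * k) ≡ k * (9 * k)
      nine = solve-∀
    k≤sizeBound : ∀ k → k ≤ sizeBound k
    k≤sizeBound k = subst (k ≤_) (cong (k *_) (+-comm 1 (9 * k))) (m≤m*n k (1 + 9 * k))

theorem1p2 : ∀ (q : ℕ) → 2 ≤ q →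
    Σ[ K ∈ Kernelization (DualIndexCoding q) ]
    (∀ (I : Instance) →
    order (kernel K I) ≤ 3 * param (kernel K I) ∸ 3 ×
    param (kernel K I) ≤ param I)
theorem1p2 (suc (suc r)) _            = Codes.kernelization r
theorem1p2 (suc zero)    (s≤s ())
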